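{- Let $\mathcal{C}_2$ be the class of $2$-connected cubic graphs, and let $\mathcal{G}$ be a subclass of $\mathcal{C}_2$ closed under taking minors in $\mathcal{C}_2$, i.e., if $G_1 \in \mathcal{G}$ and $G_2 \in \mathcal{C}_2$ is a minor of $G_1$, then $G_2 \in \mathcal{G}$. Let $G$ be an element of $\mathcal{G}$ having no orientable closed $2$-cell embedding (equivalently, no orientable cycle double cover) and, subject to that, having the fewest edges. Then $G$ has no $4$-cycle.
   Context: Graphs are finite and may have multiple edges but no loops. A surface is a connected compact $2$-manifold without boundary. A closed $2$-cell embedding of a graph in a surface is an embedding such that every face (component of the complement of the graph) is homeomorphic to an open disk and is bounded by a cycle (no repeated vertices) in the graph. An orientable closed $2$-cell embedding is a closed $2$-cell embedding in some orientable surface. A cycle double cover of a graph is a collection of cycles such that each edge is contained in exactly two of them; it is orientable if the cycles can be directed so that each edge is traversed once in each direction. For cubic graphs, having an orientable closed $2$-cell embedding is equivalent to having an orientable cycle double cover. -}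

module Defs where

open import Data.Nat.Base using (ℕ; suc; _≤_)
open import Data.Nat.DivMod using (_mod_)
open import Data.Fin.Base using (Fin; toℕ)
open import Data.Fin.Properties using (_≟_)
open import Data.List.Base using (length; filter; allFin)
open import Data.Maybe.Base using (Maybe; just)
open import Data.Product using (Σ; ∃; ∃₂; ∃!; _×_; _,_)
open import Data.Sum.Base using (_⊎_)
open import Data.Unit.Base using (⊤)
open import Function.Bundles using (_⇔_)
open import Function.Definitions using (Injective)
open import Level using (0ℓ)
open import Relation.Binary.Construct.Closure.ReflexiveTransitive using (Star)
open import Relation.Binary.PropositionalEquality using (_≡_; _≢_)
open import Relation.Nullary.Decidable using (Dec; _⊎-dec_)
open import Relation.Unary using (Pred)

-- Finite multigraphs without loops.  The order of the two ends of an edge is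
-- arbitrary; it only serves to name the two directions of the edge.
record Graph : Set where
  field
    #V       : ℕ
    #E       : ℕ
    src      : Fin #E → Fin #V
    tgt      : Fin #E → Fin #V
    loopless : ∀ e → src e ≢ tgt e

  Vertex : Set
  Vertex = Fin #V

  Edge : Set
  Edge = Fin #E

  Incident : Vertex → Edge → Set
  Incident v e = src e ≡ v ⊎ tgt e ≡ v

  incident? : ∀ v e → Dec (Incident v e)
  incident? v e = (src e ≟ v) ⊎-dec (tgt e ≟ v)

  Joins : Edge → Vertex → Vertex → Set
  Joins e u v = (src e ≡ u × tgt e ≡ v) ⊎ (src e ≡ v × tgt e ≡ u)

  Adjacent : Vertex → Vertex → Set
  Adjacent u v = ∃ λ e → Joins e u v

  -- Loops are absent, so no incident edge needs to be counted twice.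
  degree : Vertex → ℕ
  degree v = length (filter (incident? v) (allFin #E))

  -- Any two vertices in P are joined by a walk inside P.  (This allows P to
  -- be empty; nonemptiness is required separately where it matters.)
  ConnectedOn : Pred Vertex 0ℓ → Set
  ConnectedOn P =
    ∀ {u v} → P u → P v → Star (λ x y → P x × P y × Adjacent x y) u v

open Graph using (#V; #E; Vertex; Edge; src; tgt)

Cubic : Pred Graph 0ℓ
Cubic G = ∀ v → Graph.degree G v ≡ 3

-- As usual for multigraphs, the cubic graph formed by two vertices and three
-- parallel edges counts as 2-connected, whence 2 ≤ #V rather than 3 ≤ #V.
TwoConnected : Pred Graph 0ℓ
TwoConnected G =
    2 ≤ #V G
  × Graph.ConnectedOn G (λ _ → ⊤)
  × (∀ v → Graph.ConnectedOn G (λ u → u ≢ v))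

𝒞₂ : Pred Graph 0ℓ
𝒞₂ G = TwoConnected G × Cubic G

-- H ≼ G: H is isomorphic to a graph obtained from G by deleting vertices and
-- edges and contracting edges.  `branch` sends every vertex of G either to
-- `nothing` (it is deleted) or to the vertex of H it is contracted into, and
-- `edge` says which edge of G survives as a given edge of H.
record _≼_ (H G : Graph) : Set where
  field
    branch           : Vertex G → Maybe (Vertex H)
    branch-nonempty  : ∀ x → ∃ λ v → branch v ≡ just x
    branch-connected : ∀ x → Graph.ConnectedOn G (λ v → branch v ≡ just x)
    edge             : Edge H → Edge G
    edge-injective   : Injective _≡_ _≡_ edge
    edge-joins       : ∀ e → ∃₂ λ u v →
                         Graph.Joins G (edge e) u v
                       × branch u ≡ just (src H e)
                       × branch v ≡ just (tgt H e)

infix 4 _≼_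

MinorClosedIn𝒞₂ : ∀ {ℓ} → Pred Graph ℓ → Set ℓ
MinorClosedIn𝒞₂ 𝒢 = ∀ G₁ G₂ → 𝒢 G₁ → 𝒞₂ G₂ → G₂ ≼ G₁ → 𝒢 G₂

-- The successor of i modulo k.
next : ∀ {k} → Fin k → Fin k
next {suc k} i = suc (toℕ i) mod suc k

-- A cycle of length k, given by traversing it from some starting vertex in one
-- of its two directions: edge i is traversed from vertex i to vertex i + 1,
-- with indices mod k.  Two parallel edges form a cycle of length 2;
-- edge-injective keeps a single edge walked back and forth from being one.
record Cycle (G : Graph) (k : ℕ) : Set where
  field
    2≤length         : 2 ≤ k
    vertex           : Fin k → Vertex G
    edge             : Fin k → Edge G
    vertex-injective : Injective _≡_ _≡_ vertex
    edge-injective   : Injective _≡_ _≡_ edge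
    edge-joins       : ∀ i → Graph.Joins G (edge i) (vertex i) (vertex (next i))

module _ {G : Graph} where

  Contains : ∃ (Cycle G) → Edge G → Set
  Contains (_ , C) e = ∃ λ i → Cycle.edge C i ≡ e

  TraversesFrom : ∃ (Cycle G) → Edge G → Vertex G → Set
  TraversesFrom (_ , C) e u = ∃ λ i → Cycle.edge C i ≡ e × Cycle.vertex C i ≡ u

  IsCycleDoubleCover : ∀ {n} → (Fin n → ∃ (Cycle G)) → Set
  IsCycleDoubleCover 𝒟 = ∀ e → ∃₂ λ i j →
    i ≢ j × (∀ k → Contains (𝒟 k) e ⇔ (k ≡ i ⊎ k ≡ j))

  -- Within one cycle an edge occurs only once, so it suffices to count cycles.
  TraversesOnceEachWay : ∀ {n} → (Fin n → ∃ (Cycle G)) → Set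
  TraversesOnceEachWay 𝒟 = ∀ e →
      ∃! _≡_ (λ i → TraversesFrom (𝒟 i) e (src G e))
    × ∃! _≡_ (λ i → TraversesFrom (𝒟 i) e (tgt G e))

-- Every member of Cycle G k carries a direction, so choosing directions for
-- the cycles of a double cover is part of choosing the family 𝒟.
HasOrientableCDC : Pred Graph 0ℓ
HasOrientableCDC G = ∃ λ n → Σ (Fin n → ∃ (Cycle G)) λ 𝒟 →
  IsCycleDoubleCover 𝒟 × TraversesOnceEachWay 𝒟

-- An orientable cycle double cover of a cubic graph amounts to labelling the darts (directed edges)
-- by faces so that at every vertex the three outgoing labels are distinct and the incoming labels
-- are a derangement of them.  This condition is local, so a cover of a smaller graph is extended to G
-- by labelling the darts of a short cycle only.
--
-- If the third edges at a 4-cycle v₀v₁v₂v₃ lead to vertices u₀, u₁, u₂, u₃ off the cycle, replace the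
-- cycle by the edges u₀u₃ and u₁u₂, or by u₀u₁ and u₂u₃.  One of the two results is 2-connected:
-- otherwise two partitions of the remaining vertices, each crossed by at most one edge, cut them into
-- four quarters, one of which sends no edge to the others and so is separated by a bridge of G.
-- Every cover of the smaller graph extends.  Let F₁, F₂ be the faces along u₀u₃, u₃u₀ and F₃, F₄
-- those along u₁u₂, u₂u₁.  If F₁ = F₄ or F₂ = F₃, the 4-cycle becomes a new face; otherwise, if
-- F₁ ≠ F₃ or F₂ ≠ F₄, two of the faces take a detour around the cycle; and if F₁ = F₃ and F₂ = F₄,
-- the two faces split into four, which cross at the cycle.
--
-- If a third edge is a chord of the cycle, G has a triangle or a digon instead; a triangle is
-- contracted to a vertex and a digon to an edge.

module Submission where

open import Defs
open import Data.Bool.Base using (Bool; true; false; not; _∧_; _xor_)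
open import Data.Bool.Properties as 𝔹 using (not-involutive; ¬-not; not-¬)
open import Data.Empty using (⊥; ⊥-elim)
open import Data.Fin.Base using (Fin; zero; suc; toℕ; fromℕ; fromℕ<; inject₁; combine; remQuot; _↑ˡ_; _↑ʳ_)
open import Data.Fin.Patterns using (0F; 1F; 2F; 3F)
open import Data.Fin.Properties using (_≟_; any?; all?; ¬∀⟶∃¬; suc-injective; toℕ-injective; toℕ<n; toℕ-fromℕ; toℕ-fromℕ<; toℕ-inject₁; ↑ˡ-injective; combine-remQuot; remQuot-combine; pigeonhole; injective⇒≤)
open import Data.List.Base using (List; length; filter; allFin; lookup; _∷_)
open import Data.List.Membership.Propositional.Properties using (∈-allFin; ∈-filter⁺; ∈-filter⁻; ∈-lookup)
open import Data.List.Relation.Unary.All as All using ()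
open import Data.List.Relation.Unary.AllPairs as AllPairs using ()
open import Data.List.Relation.Unary.Any using (index)
open import Data.List.Relation.Unary.Any.Properties using (lookup-index)
open import Data.List.Relation.Unary.Unique.Propositional using (Unique)
import Data.List.Relation.Unary.Unique.Propositional.Properties as Unique
open import Data.Maybe.Base using (Maybe; just; nothing; maybe)
open import Data.Maybe.Properties as Maybe using (just-injective)
open import Data.Nat.Base using (ℕ; zero; suc; _≤_; _<_; z≤n; s≤s; _+_; _∸_; _*_)
open import Data.Nat.DivMod using (m<n⇒m%n≡m; n%n≡0)
open import Data.Nat.GeneralisedArithmetic using (fold; fold-+)
open import Data.Nat.Induction using (<-wellFounded)
import Data.Nat.Properties as ℕₚ
open import Data.Product using (∃; ∃!; ∃₂; _×_; _,_; proj₁; proj₂)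
open import Data.Sum.Base using (_⊎_; inj₁; inj₂; [_,_]; [_,_]′)
open import Data.Sum.Properties using (inj₁-injective; inj₂-injective)
open import Data.Unit.Base using (⊤; tt)
open import Function.Base using (_∘_; id)
open import Function.Bundles using (mk⇔)
open import Function.Definitions using (Injective)
open import Induction.WellFounded using (Acc; acc)
open import Level using (Level; 0ℓ)
open import Relation.Binary.Construct.Closure.ReflexiveTransitive as Star using (Star; ε; _◅_; _◅◅_)
open import Relation.Binary.Definitions using (tri<; tri≈; tri>)
open import Relation.Binary.PropositionalEquality using (_≡_; _≢_; refl; sym; trans; cong; cong₂; subst; subst₂)
open import Relation.Nullary.Decidable using (Dec; yes; no; does; _⊎-dec_; _×-dec_; ¬?; map′; dec-true; dec-false; does-⇔; toWitness; ¬¬-excluded-middle)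
open import Relation.Nullary.Negation using (¬_; contradiction)
open import Relation.Unary using (Pred; _⊆_)

-- A label may sit on several disjoint cycles, so rerouting faces at the rim needs no check far from
-- it: what the new faces look like globally is settled once, by taking orbits. The one exception is
-- the case F₁ = F₃ and F₂ = F₄. There only two labels reach the rim, and the two passages of each
-- face have to be told apart by the cyclic order along that face, so positions on the actual cycles
-- of the cover come in. Two-connectedness is handled through colourings: a 2-colouring of the
-- vertices with at most one bichromatic edge is constant. Painting the whole rim in one colour then
-- turns colourings of the smaller graph into colourings of G, and the quarters become Boolean
-- conjunctions. For cubic graphs this property gives back connectedness by walks only under double
-- negation, which is harmless because the theorem is a negation. The new edges would be loops if
-- paired feet coincided. Such a foot by itself is one side of a forbidden partition, so no separate
-- reduction is needed for it.

-- Finite enumerations and cyclic indices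

lookup-injective : ∀ {A : Set} {xs : List A} → Unique xs → Injective _≡_ _≡_ (lookup xs)
lookup-injective (_ AllPairs.∷ _) {zero} {zero} _ = refl
lookup-injective {xs = _ ∷ xs} (px AllPairs.∷ _) {zero} {suc j} eq =
  contradiction eq (All.lookup px (∈-lookup j))
lookup-injective {xs = _ ∷ xs} (px AllPairs.∷ _) {suc i} {zero} eq =
  contradiction (sym eq) (All.lookup px (∈-lookup i))
lookup-injective (_ AllPairs.∷ u) {suc i} {suc j} eq = cong suc (lookup-injective u eq)

record Enumeration {N} (P : Fin N → Set) (n : ℕ) : Set where
  field
    at        : Fin n → Fin N
    injective : Injective _≡_ _≡_ at
    sound     : ∀ i → P (at i)
    complete  : ∀ {x} → P x → ∃ λ i → at i ≡ x

enumerate : ∀ {N} {P : Fin N → Set} (P? : ∀ x → Dec (P x)) →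
            Enumeration P (length (filter P? (allFin N)))
enumerate {N} P? = record
  { at        = lookup (filter P? (allFin N))
  ; injective = lookup-injective (Unique.filter⁺ P? (Unique.allFin⁺ N))
  ; sound     = λ i → proj₂ (∈-filter⁻ P? {xs = allFin N} (∈-lookup i))
  ; complete  = λ {x} px → let m = ∈-filter⁺ P? (∈-allFin x) px in index m , sym (lookup-index m)
  }

enumeration-≤ : ∀ {N} {P : Fin N → Set} {m n} → Enumeration P m → Enumeration P n → m ≤ n
enumeration-≤ e f = injective⇒≤ {f = λ i → proj₁ (F.complete (E.sound i))} λ {i} {j} eq →
  E.injective (trans (sym (proj₂ (F.complete (E.sound i))))
              (trans (cong F.at eq) (proj₂ (F.complete (E.sound j)))))
  where module E = Enumeration e
        module F = Enumeration f

-- Since `degree` is the length of a filtered list, this lets any explicit listing of the incident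
-- edges determine it.
enumeration-unique : ∀ {N} {P : Fin N → Set} {m n} → Enumeration P m → Enumeration P n → m ≡ n
enumeration-unique e f = ℕₚ.≤-antisym (enumeration-≤ e f) (enumeration-≤ f e)

toℕ-next : ∀ {k} (i : Fin k) → suc (toℕ i) < k → toℕ (next i) ≡ suc (toℕ i)
toℕ-next {suc k} i lt = trans (toℕ-fromℕ< _) (m<n⇒m%n≡m lt)

toℕ-next-last : ∀ {k} (i : Fin k) → suc (toℕ i) ≡ k → toℕ (next i) ≡ 0
toℕ-next-last {suc k} i eq rewrite eq = trans (toℕ-fromℕ< _) (n%n≡0 (suc k))

next-cases : ∀ {k} (i : Fin k) →
  (suc (toℕ i) < k × toℕ (next i) ≡ suc (toℕ i)) ⊎ (suc (toℕ i) ≡ k × toℕ (next i) ≡ 0)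
next-cases i with ℕₚ.m≤n⇒m<n∨m≡n (toℕ<n i)
... | inj₁ lt = inj₁ (lt , toℕ-next i lt)
... | inj₂ eq = inj₂ (eq , toℕ-next-last i eq)

next-injective : ∀ {k} → Injective _≡_ _≡_ (next {k})
next-injective {x = i} {y = j} eq with next-cases i | next-cases j
... | inj₁ (_ , p) | inj₁ (_ , q) =
  toℕ-injective (ℕₚ.suc-injective (trans (sym p) (trans (cong toℕ eq) q)))
... | inj₁ (_ , p) | inj₂ (_ , q) =
  contradiction (trans (sym p) (trans (cong toℕ eq) q)) λ ()
... | inj₂ (_ , p) | inj₁ (_ , q) =
  contradiction (trans (sym q) (trans (cong toℕ (sym eq)) p)) λ ()
... | inj₂ (p , _) | inj₂ (q , _) = toℕ-injective (ℕₚ.suc-injective (trans p (sym q)))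

prev : ∀ {k} → Fin k → Fin k
prev {suc k} zero    = fromℕ k
prev {suc k} (suc i) = inject₁ i

next-prev : ∀ {k} (i : Fin k) → next (prev i) ≡ i
next-prev {suc k} zero = toℕ-injective (toℕ-next-last (fromℕ k) (cong suc (toℕ-fromℕ k)))
next-prev {suc (suc k)} (suc i) = toℕ-injective (trans
  (toℕ-next (inject₁ i) (s≤s (subst (_< suc k) (sym (toℕ-inject₁ i)) (toℕ<n i))))
  (cong suc (toℕ-inject₁ i)))

prev-next : ∀ {k} (i : Fin k) → prev (next i) ≡ i
prev-next i = next-injective (next-prev (next i))

next-≢ : ∀ {k} → 2 ≤ k → (i : Fin k) → next i ≢ i
next-≢ 2≤k i eq with next-cases i
... | inj₁ (_ , p) = contradiction (trans (sym p) (cong toℕ eq)) ℕₚ.1+n≢n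
... | inj₂ (p , q) = contradiction
  (subst (2 ≤_) (trans (sym p) (cong suc (trans (cong toℕ (sym eq)) q))) 2≤k) λ { (s≤s ()) }

least : ∀ {P : ℕ → Set} → (∀ n → Dec (P n)) → ∀ {n} → P n → ∃ λ m → P m × (∀ {k} → k < m → ¬ P k)
least {P} P? {n} p with P? 0
... | yes p₀ = 0 , p₀ , λ ()
least {P} P? {zero}  p | no ¬p₀ = contradiction p ¬p₀
least {P} P? {suc n} p | no ¬p₀ with least (λ k → P? (suc k)) p
... | m , pm , min = suc m , pm , λ { {zero} _ → ¬p₀ ; {suc k} (s≤s lt) → min lt }

-- Orbits of a permutation

module Orbits {M} (φ : Fin M → Fin M) (φ-injective : Injective _≡_ _≡_ φ) where

  iter : ℕ → Fin M → Fin M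
  iter k d = fold d φ k

  iter-+ : ∀ j k d → iter (j + k) d ≡ iter j (iter k d)
  iter-+ j k d = fold-+ d φ j

  iter-injective : ∀ k → Injective _≡_ _≡_ (iter k)
  iter-injective zero    eq = eq
  iter-injective (suc k) eq = iter-injective k (φ-injective eq)

  iter-cancel : ∀ {j k} d → j < k → iter j d ≡ iter k d → iter (suc (k ∸ suc j)) d ≡ d
  iter-cancel {j} {k} d lt eq = iter-injective j (trans (sym (iter-+ j (suc (k ∸ suc j)) d))
    (trans (cong (λ x → iter x d) (trans (ℕₚ.+-suc j _) (ℕₚ.m+[n∸m]≡n lt))) (sym eq)))

  record Period (d : Fin M) : Set where
    field
      pred    : ℕ
      bounded : pred < M
      returns : iter (suc pred) d ≡ d
      minimal : ∀ {k} → k < pred → iter (suc k) d ≢ d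

  abstract
    -- Among `M + 1` iterates two coincide; injectivity cancels the common initial part, which
    -- leaves a return to `d`, and the least return time is taken.
    period : ∀ d → Period d
    period d with i , j , i<j , eq ← pigeonhole (ℕₚ.n<1+n M) (λ (i : Fin (suc M)) → iter (toℕ i) d)
             with p , ret , min ← least (λ n → iter (suc n) d ≟ d) {toℕ j ∸ suc (toℕ i)} (iter-cancel d i<j eq)
      = record { pred = p ; returns = ret ; minimal = min
               ; bounded = ℕₚ.≤-<-trans (ℕₚ.≮⇒≥ (λ lt → min lt (iter-cancel d i<j eq)))
                           (ℕₚ.<-≤-trans (ℕₚ.∸-monoʳ-< {o = 0} (s≤s z≤n) i<j)
                                         (ℕₚ.≤-pred (toℕ<n j))) }

  module _ {d} (P : Period d) where

    open Period P

    iter-distinct : ∀ {i j : Fin (suc pred)} → toℕ i < toℕ j → iter (toℕ i) d ≢ iter (toℕ j) d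
    iter-distinct {i} {j} lt eq = minimal {toℕ j ∸ suc (toℕ i)}
      (ℕₚ.<-≤-trans (ℕₚ.∸-monoʳ-< {toℕ j} {o = 0} (s≤s z≤n) lt) (ℕₚ.≤-pred (toℕ<n j))) (iter-cancel d lt eq)

    iter-periodic : ∀ {i j : Fin (suc pred)} → iter (toℕ i) d ≡ iter (toℕ j) d → i ≡ j
    iter-periodic {i} {j} eq with ℕₚ.<-cmp (toℕ i) (toℕ j)
    ... | tri< lt _ _ = contradiction eq (iter-distinct {i} {j} lt)
    ... | tri≈ _ e _  = toℕ-injective e
    ... | tri> _ _ gt = contradiction (sym eq) (iter-distinct {j} {i} gt)

    iter-next : ∀ (i : Fin (suc pred)) → iter (toℕ (next i)) d ≡ φ (iter (toℕ i) d)
    iter-next i with next-cases i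
    ... | inj₁ (_ , p) = cong (λ k → iter k d) p
    ... | inj₂ (p , q) = trans (cong (λ k → iter k d) q)
            (trans (sym returns) (cong (λ k → iter (suc k) d) (sym (ℕₚ.suc-injective p))))

  iter-wrap : ∀ {p d} → iter (suc p) d ≡ d → ∀ k → ∃ λ j → j ≤ p × iter j d ≡ iter k d
  iter-wrap ret zero = 0 , z≤n , refl
  iter-wrap {p} ret (suc k) with iter-wrap ret k
  ... | j , j≤p , eq with ℕₚ.m≤n⇒m<n∨m≡n j≤p
  ... | inj₁ lt   = suc j , lt , cong φ eq
  ... | inj₂ refl = 0 , z≤n , trans (sym ret) (cong φ eq)

  infix 4 _⇝_
  _⇝_ : Fin M → Fin M → Set
  d ⇝ d′ = ∃ λ k → iter k d ≡ d′

  ⇝-trans : ∀ {a b c} → a ⇝ b → b ⇝ c → a ⇝ c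
  ⇝-trans {a} (j , refl) (k , refl) = k + j , iter-+ k j a

  ⇝-bounded : ∀ {d d′} → d ⇝ d′ → ∃ λ (i : Fin M) → iter (toℕ i) d ≡ d′
  ⇝-bounded {d} (k , refl) with iter-wrap (Period.returns (period d)) k
  ... | j , j≤p , eq = fromℕ< lt , trans (cong (λ x → iter x d) (toℕ-fromℕ< lt)) eq
    where lt = ℕₚ.≤-<-trans j≤p (Period.bounded (period d))

  ⇝-sym : ∀ {d d′} → d ⇝ d′ → d′ ⇝ d
  ⇝-sym {d} (k , refl) with iter-wrap (Period.returns (period d)) k
  ... | j , j≤p , eq = suc p ∸ j , trans (cong (iter (suc p ∸ j)) (sym eq))
      (trans (sym (iter-+ (suc p ∸ j) j d))
      (trans (cong (λ x → iter x d) (ℕₚ.m∸n+n≡m (ℕₚ.m≤n⇒m≤1+n j≤p))) (Period.returns (period d))))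
    where p = Period.pred (period d)

  -- The canonical representative of an orbit, so that the faces can be enumerated by filtering. `M`
  -- iterates suffice because no period exceeds `M`.
  Least : Fin M → Set
  Least d = ∀ (i : Fin M) → toℕ d ≤ toℕ (iter (toℕ i) d)

  least? : ∀ d → Dec (Least d)
  least? d = all? λ i → toℕ d ℕₚ.≤? toℕ (iter (toℕ i) d)

  least-≤ : ∀ {d d′} → Least d → d ⇝ d′ → toℕ d ≤ toℕ d′
  least-≤ l r with ⇝-bounded r
  ... | i , refl = l i

  least-unique : ∀ {d d′} → Least d → Least d′ → d ⇝ d′ → d ≡ d′
  least-unique l l′ r = toℕ-injective (ℕₚ.≤-antisym (least-≤ l r) (least-≤ l′ (⇝-sym r)))

  abstract
    least-exists : ∀ d → ∃ λ r → Least r × r ⇝ d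
    least-exists d = go d (<-wellFounded (toℕ d))
      where
      go : ∀ d → Acc _<_ (toℕ d) → ∃ λ r → Least r × r ⇝ d
      go d (acc rs) with least? d
      ... | yes l = d , l , 0 , refl
      ... | no ¬l with ¬∀⟶∃¬ M _ (λ i → toℕ d ℕₚ.≤? toℕ (iter (toℕ i) d)) ¬l
      ... | i , ≰ with go (iter (toℕ i) d) (rs (ℕₚ.≰⇒> ≰))
      ... | r , l , reach = r , l , ⇝-trans reach (⇝-sym (toℕ i , refl))

-- Orientable cycle double covers as labellings of darts

-- With arbitrary types of vertices and edges, a graph cut along a cycle can use sums for its parts
-- instead of a renumbering by `Fin`.
record Multigraph : Set₁ where
  field
    V E     : Set
    src tgt : E → V

  Dart : Set
  Dart = E × Bool

  tail : Dart → V
  tail (e , false) = src e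
  tail (e , true)  = tgt e

  rev : Dart → Dart
  rev (e , b) = e , not b

  head : Dart → V
  head d = tail (rev d)

  rev-rev : ∀ d → rev (rev d) ≡ d
  rev-rev (e , b) = cong (e ,_) (not-involutive b)

open Multigraph using (V; E; Dart; tail; head; rev; src; tgt)

⟦_⟧ : Graph → Multigraph
⟦ G ⟧ = record { V = Graph.Vertex G ; E = Graph.Edge G ; src = Graph.src G ; tgt = Graph.tgt G }

-- o d and ι d are the faces running out of v along d and into v along rev d.
record GoodAt (A : Multigraph) {L : Set} (o ι : Dart A → L) (v : V A) : Set where
  field
    out-injective : ∀ d d′ → tail A d ≡ v → tail A d′ ≡ v → o d ≡ o d′ → d ≡ d′
    in-injective  : ∀ d d′ → tail A d ≡ v → tail A d′ ≡ v → ι d ≡ ι d′ → d ≡ d′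
    turns         : ∀ d → tail A d ≡ v → o d ≢ ι d
    successor     : ∀ d → tail A d ≡ v → ∃ λ d′ → tail A d′ ≡ v × o d′ ≡ ι d

-- The darts with a given label may form several disjoint cycles.
record FaceLabelling (A : Multigraph) : Set₁ where
  field
    Label : Set
    label : Dart A → Label
    good  : ∀ v → GoodAt A label (label ∘ rev A) v

module _ (G : Graph) where

  open Graph G using (Joins; loopless)

  private A = ⟦ G ⟧

  dart-≡ : ∀ (d d′ : Dart A) → proj₁ d ≡ proj₁ d′ → tail A d ≡ tail A d′ → d ≡ d′
  dart-≡ (e , false) (_ , false) refl _  = refl
  dart-≡ (e , false) (_ , true)  refl eq = contradiction eq (loopless e)
  dart-≡ (e , true)  (_ , false) refl eq = contradiction (sym eq) (loopless e)
  dart-≡ (e , true)  (_ , true)  refl _  = refl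

  joins-dart : ∀ (d : Dart A) → Joins (proj₁ d) (tail A d) (head A d)
  joins-dart (e , false) = inj₁ (refl , refl)
  joins-dart (e , true)  = inj₂ (refl , refl)

  dart-from : ∀ {e u v} → Joins e u v → ∃ λ d → proj₁ d ≡ e × tail A d ≡ u × head A d ≡ v
  dart-from {e} (inj₁ (p , q)) = (e , false) , refl , p , q
  dart-from {e} (inj₂ (p , q)) = (e , true) , refl , q , p

  joins-head : ∀ (d : Dart A) {w} → Joins (proj₁ d) (tail A d) w → head A d ≡ w
  joins-head (e , false) (inj₁ (_ , q)) = q
  joins-head (e , false) (inj₂ (_ , q)) = contradiction (sym q) (loopless e)
  joins-head (e , true)  (inj₁ (p , _)) = contradiction p (loopless e)
  joins-head (e , true)  (inj₂ (p , _)) = p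

  no-loop : ∀ (d : Dart A) → tail A d ≢ head A d
  no-loop (e , false) eq = loopless e eq
  no-loop (e , true)  eq = loopless e (sym eq)

  same-edge : ∀ (d d′ : Dart A) → proj₁ d ≡ proj₁ d′ → d ≡ d′ ⊎ rev A d ≡ d′
  same-edge (e , false) (_ , false) refl = inj₁ refl
  same-edge (e , false) (_ , true)  refl = inj₂ refl
  same-edge (e , true)  (_ , false) refl = inj₂ refl
  same-edge (e , true)  (_ , true)  refl = inj₁ refl

module LabellingFromCDC (G : Graph) {n} (𝒟 : Fin n → ∃ (Cycle G)) (once : TraversesOnceEachWay 𝒟) where

  private
    A = ⟦ G ⟧
    module C (k : Fin n) = Cycle (proj₂ (𝒟 k))

  len : Fin n → ℕ
  len k = proj₁ (𝒟 k)

  Occurs : ∀ k → Fin (len k) → Dart A → Set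
  Occurs k i d = C.edge k i ≡ proj₁ d × C.vertex k i ≡ tail A d

  abstract
    located : ∀ d → ∃ λ k → ∃ λ i → Occurs k i d
    located (e , false) with k , (i , p , q) , _ ← proj₁ (once e) = k , i , p , q
    located (e , true)  with k , (i , p , q) , _ ← proj₂ (once e) = k , i , p , q

    face-unique : ∀ d {k i} → Occurs k i d → proj₁ (located d) ≡ k
    face-unique (e , false) (p , q) = proj₂ (proj₂ (proj₁ (once e))) (_ , p , q)
    face-unique (e , true)  (p , q) = proj₂ (proj₂ (proj₂ (once e))) (_ , p , q)

  face : Dart A → Fin n
  face d = proj₁ (located d)

  pos : Dart A → ℕ
  pos d = toℕ (proj₁ (proj₂ (located d)))

  occurs : ∀ d {k} → face d ≡ k → ∃ λ i → Occurs k i d × toℕ i ≡ pos d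
  occurs d refl = _ , proj₂ (proj₂ (located d)) , refl

  pos<len : ∀ d → pos d < len (face d)
  pos<len d = toℕ<n _

  pos-unique : ∀ d {k i} → Occurs k i d → toℕ i ≡ pos d
  pos-unique d {k} {i} o with occurs d (face-unique d o)
  ... | j , (p , _) , eq = trans (cong toℕ (C.edge-injective k (trans (proj₁ o) (sym p)))) eq

  occurs-head : ∀ d {k i} → Occurs k i d → C.vertex k (next i) ≡ head A d
  occurs-head d {k} {i} (refl , q) = sym (joins-head G d
    (subst (λ v → Graph.Joins G (C.edge k i) v (C.vertex k (next i))) q (C.edge-joins k i)))

  occurs-next : ∀ d {k i} → Occurs k i d → ∃ λ d′ → tail A d′ ≡ head A d × Occurs k (next i) d′
  occurs-next d {k} {i} o with dart-from G (C.edge-joins k (next i))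
  ... | d′ , p , q , _ = d′ , trans q (occurs-head d o) , sym p , sym q

  follow : Dart A → Dart A
  follow d = proj₁ (occurs-next d (proj₂ (proj₂ (located d))))

  follow-tail : ∀ d → tail A (follow d) ≡ head A d
  follow-tail d = proj₁ (proj₂ (occurs-next d (proj₂ (proj₂ (located d)))))

  follow-occurs : ∀ d → Occurs (face d) (next (proj₁ (proj₂ (located d)))) (follow d)
  follow-occurs d = proj₂ (proj₂ (occurs-next d (proj₂ (proj₂ (located d)))))

  follow-face : ∀ d → face (follow d) ≡ face d
  follow-face d = face-unique (follow d) (follow-occurs d)

  -- A cycle visits a vertex once, so a common face and a common tail put both darts at the same
  -- position of the same cycle.
  out-injective : ∀ d d′ → tail A d ≡ tail A d′ → face d ≡ face d′ → d ≡ d′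
  out-injective d d′ eq f with occurs d f | occurs d′ refl
  ... | i , (p , q) , _ | j , (p′ , q′) , _
    with refl ← C.vertex-injective (face d′) (trans q (trans eq (sym q′)))
    = dart-≡ G d d′ (trans (sym p) p′) eq

  in-injective : ∀ d d′ → head A d ≡ head A d′ → face d ≡ face d′ → d ≡ d′
  in-injective d d′ eq f with occurs d f | occurs d′ refl
  ... | i , o@(p , q) , _ | j , o′@(p′ , q′) , _
    with refl ← next-injective (C.vertex-injective (face d′)
                  (trans (occurs-head d o) (trans eq (sym (occurs-head d′ o′)))))
    = dart-≡ G d d′ (trans (sym p) p′) (trans (sym q) q′)

  -- On one cycle an edge has a single position, and that position has a single tail; a dart and its
  -- reverse have different tails.
  face-rev : ∀ d → face d ≢ face (rev A d)
  face-rev d f with occurs d f | occurs (rev A d) refl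
  ... | i , (p , q) , _ | j , (p′ , q′) , _
    with refl ← C.edge-injective (face (rev A d)) (trans p (sym p′))
    = no-loop G d (trans (sym q) q′)

  rev-injective : ∀ d d′ → rev A d ≡ rev A d′ → d ≡ d′
  rev-injective d d′ eq = trans (sym (Multigraph.rev-rev A d))
    (trans (cong (rev A) eq) (Multigraph.rev-rev A d′))

  -- Refining the faces by β stays good when the label seen at the end of a dart is that of its follower.
  module _ {L : Set} (β : Dart A → L) where

    refined-out refined-in : Dart A → Fin n × L
    refined-out d = face d , β d
    refined-in  d = face (rev A d) , β (follow (rev A d))

    refined-good : ∀ v → GoodAt A refined-out refined-in v
    refined-good v = record
      { out-injective = λ d d′ p q eq → out-injective d d′ (trans p (sym q)) (cong proj₁ eq)
      ; in-injective  = λ d d′ p q eq → rev-injective d d′ (in-injective (rev A d) (rev A d′)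
          (trans (head-rev d) (trans p (trans (sym q) (sym (head-rev d′))))) (cong proj₁ eq))
      ; turns         = λ d _ eq → face-rev d (cong proj₁ eq)
      ; successor     = λ d p → follow (rev A d)
          , trans (follow-tail (rev A d)) (trans (head-rev d) p)
          , cong (_, β (follow (rev A d))) (follow-face (rev A d))
      }
      where
      head-rev : ∀ d → head A (rev A d) ≡ tail A d
      head-rev d = cong (tail A) (Multigraph.rev-rev A d)

  face-good : ∀ v → GoodAt A face (face ∘ rev A) v
  face-good v = record
    { out-injective = λ d d′ p q eq → R.out-injective d d′ p q (cong (_, 0) eq)
    ; in-injective  = λ d d′ p q eq → R.in-injective d d′ p q (cong (_, 0) eq)
    ; turns         = λ d p → face-rev d
    ; successor     = λ d p → let d′ , t , f = R.successor d p in d′ , t , cong proj₁ f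
    }
    where module R = GoodAt (refined-good (λ _ → 0) v)

  pos-follow : ∀ d → (suc (pos d) < len (face d) × pos (follow d) ≡ suc (pos d))
                   ⊎ (suc (pos d) ≡ len (face d) × pos (follow d) ≡ 0)
  pos-follow d with next-cases (proj₁ (proj₂ (located d)))
  ... | inj₁ (p , q) = inj₁ (p , trans (sym (pos-unique (follow d) (follow-occurs d))) q)
  ... | inj₂ (p , q) = inj₂ (p , trans (sym (pos-unique (follow d) (follow-occurs d))) q)

  pos-injective : ∀ d d′ → face d ≡ face d′ → pos d ≡ pos d′ → d ≡ d′
  pos-injective d d′ f eq with occurs d f | occurs d′ refl
  ... | i , (p , q) , r | j , (p′ , q′) , r′ with refl ← toℕ-injective {i = i} {j = j} (trans r (trans eq (sym r′)))
    = dart-≡ G d d′ (trans (sym p) p′) (trans (sym q) q′)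

  -- Cutting the face of a and b in the middle of a and of b leaves two arcs, told apart by side.
  record Bisection (a b : Dart A) : Set where
    field
      side          : Dart A → Bool
      side-a        : side a ≡ side (follow b)
      side-b        : side b ≡ side (follow a)
      side-separate : side a ≢ side b
      side-const    : ∀ d → d ≢ a → d ≢ b → side (follow d) ≡ side d
      side-off      : ∀ d → face d ≢ face a → side d ≡ false

  -- One arc occupies the positions after that of `a` up to and including that of `b`; the other is
  -- the remainder and wraps around position 0.
  bisect-< : ∀ a b → face a ≡ face b → pos a < pos b → Bisection a b
  bisect-< a b f lt = record
    { side          = side
    ; side-a        = trans a-out (sym (dec-false (inside? (follow b)) not-fb))
    ; side-b        = trans b-in (sym (dec-true (inside? (follow a)) fa))
    ; side-separate = λ eq → contradiction (trans (sym a-out) (trans eq b-in)) λ ()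
    ; side-const    = λ d ≢a ≢b → does-⇔ (mk⇔ (back d ≢a) (forth d ≢b)) (inside? (follow d)) (inside? d)
    ; side-off      = λ d ≢f → dec-false (inside? d) (λ (f , _) → ≢f f)
    }
    where
    Inside : Dart A → Set
    Inside d = face d ≡ face a × pos a < pos d × pos d ≤ pos b

    inside? : ∀ d → Dec (Inside d)
    inside? d = (face d ≟ face a) ×-dec ((pos a ℕₚ.<? pos d) ×-dec (pos d ℕₚ.≤? pos b))

    side : Dart A → Bool
    side d = does (inside? d)

    a-out : side a ≡ false
    a-out = dec-false (inside? a) λ (_ , l , _) → ℕₚ.<-irrefl refl l

    b-in : side b ≡ true
    b-in = dec-true (inside? b) (sym f , lt , ℕₚ.≤-refl)

    fa : Inside (follow a)
    fa with pos-follow a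
    ... | inj₁ (_ , p) = follow-face a , subst (pos a <_) (sym p) (ℕₚ.n<1+n _) , subst (_≤ pos b) (sym p) lt
    ... | inj₂ (p , _) = contradiction
      (ℕₚ.<-≤-trans (subst (λ k → pos b < len k) (sym f) (pos<len b)) (subst (_≤ pos b) p lt)) (ℕₚ.<-irrefl refl)

    not-fb : ¬ Inside (follow b)
    not-fb (_ , l , u) with pos-follow b
    ... | inj₁ (_ , p) = ℕₚ.<-irrefl refl (subst (_≤ pos b) p u)
    ... | inj₂ (_ , p) = contradiction (subst (pos a <_) p l) λ ()

    back : ∀ d → d ≢ a → Inside (follow d) → Inside d
    back d ≢a (g , l , u) with pos-follow d
    ... | inj₁ (_ , p) = h , ℕₚ.≤∧≢⇒< (ℕₚ.≤-pred (subst (pos a <_) p l))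
                               (λ eq → ≢a (pos-injective d a h (sym eq)))
                           , ℕₚ.<⇒≤ (subst (_≤ pos b) p u)
      where h = trans (sym (follow-face d)) g
    ... | inj₂ (_ , p) = contradiction (subst (pos a <_) p l) λ ()

    forth : ∀ d → d ≢ b → Inside d → Inside (follow d)
    forth d ≢b (g , l , u) with pos-follow d
    ... | inj₁ (_ , p) = trans (follow-face d) g , subst (pos a <_) (sym p) (ℕₚ.m<n⇒m<1+n l)
                       , subst (_≤ pos b) (sym p) (ℕₚ.≤∧≢⇒< u (λ eq → ≢b (pos-injective d b (trans g f) eq)))
    ... | inj₂ (p , _) = contradiction (pos-injective d b (trans g f) (ℕₚ.≤-antisym u
            (ℕₚ.≤-pred (subst (pos b <_) (trans (cong len (trans (sym f) (sym g))) (sym p)) (pos<len b))))) ≢b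

  bisect : ∀ a b → a ≢ b → face a ≡ face b → Bisection a b
  bisect a b ≢ f with ℕₚ.<-cmp (pos a) (pos b)
  ... | tri< lt _ _ = bisect-< a b f lt
  ... | tri≈ _ eq _ = contradiction (pos-injective a b f eq) ≢
  ... | tri> _ _ gt = record
    { side = B.side ; side-a = B.side-b ; side-b = B.side-a
    ; side-separate = λ eq → B.side-separate (sym eq)
    ; side-const = λ d p q → B.side-const d q p
    ; side-off = λ d p → B.side-off d (λ q → p (trans q (sym f))) }
    where module B = Bisection (bisect-< b a (sym f) gt)

module CDCFromLabelling (G : Graph) (F : FaceLabelling ⟦ G ⟧) where

  open FaceLabelling F
  private
    A = ⟦ G ⟧
    module Good {v} = GoodAt (good v)

  abstract
    encode : Dart A → Fin (Graph.#E G * 2)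
    encode (e , false) = combine e zero
    encode (e , true)  = combine e (suc zero)

    decode : Fin (Graph.#E G * 2) → Dart A
    decode x with remQuot {Graph.#E G} 2 x
    ... | e , zero     = e , false
    ... | e , suc zero = e , true

    decode-encode : ∀ d → decode (encode d) ≡ d
    decode-encode (e , false) rewrite remQuot-combine {Graph.#E G} {2} e zero = refl
    decode-encode (e , true)  rewrite remQuot-combine {Graph.#E G} {2} e (suc zero) = refl

    encode-decode : ∀ x → encode (decode x) ≡ x
    encode-decode x with remQuot {Graph.#E G} 2 x in eq
    ... | e , zero     = trans (cong (λ (e , b) → combine e b) (sym eq)) (combine-remQuot {Graph.#E G} 2 x)
    ... | e , suc zero = trans (cong (λ (e , b) → combine e b) (sym eq)) (combine-remQuot {Graph.#E G} 2 x)

  abstract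
    follow : Dart A → Dart A
    follow d = proj₁ (Good.successor (rev A d) refl)

    follow-tail : ∀ d → tail A (follow d) ≡ head A d
    follow-tail d = proj₁ (proj₂ (Good.successor (rev A d) refl))

    follow-label : ∀ d → label (follow d) ≡ label d
    follow-label d = trans (proj₂ (proj₂ (Good.successor (rev A d) refl)))
                           (cong label (Multigraph.rev-rev A d))

    -- Darts with the same follower end at the same vertex and, since following keeps the label,
    -- carry the same label; `in-injective` at that vertex identifies them.
    follow-injective : Injective _≡_ _≡_ follow
    follow-injective {d} {d′} eq = trans (sym (Multigraph.rev-rev A d))
      (trans (cong (rev A) (Good.in-injective (rev A d) (rev A d′)
         (trans (sym (follow-tail d)) (trans (cong (tail A) eq) (follow-tail d′))) refl
         (trans (cong label (Multigraph.rev-rev A d)) (trans (sym (follow-label d))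
         (trans (cong label eq) (trans (follow-label d′) (cong label (sym (Multigraph.rev-rev A d′)))))))))
      (Multigraph.rev-rev A d′))

  φ : Fin (Graph.#E G * 2) → Fin (Graph.#E G * 2)
  φ x = encode (follow (decode x))

  encode-injective : Injective _≡_ _≡_ encode
  encode-injective {d} {d′} eq = trans (sym (decode-encode d)) (trans (cong decode eq) (decode-encode d′))

  decode-injective : Injective _≡_ _≡_ decode
  decode-injective {x} {y} eq = trans (sym (encode-decode x)) (trans (cong encode eq) (encode-decode y))

  abstract
    φ-injective : Injective _≡_ _≡_ φ
    φ-injective eq = decode-injective (follow-injective (encode-injective eq))

  open Orbits φ φ-injective

  walk : Fin (Graph.#E G * 2) → ℕ → Dart A
  walk x k = decode (iter k x)

  walk-suc : ∀ x k → walk x (suc k) ≡ follow (walk x k)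
  walk-suc x k = decode-encode _

  walk-label : ∀ x k → label (walk x k) ≡ label (decode x)
  walk-label x zero    = refl
  walk-label x (suc k) = trans (cong label (walk-suc x k)) (trans (follow-label (walk x k)) (walk-label x k))

  walk-tail : ∀ x j k → tail A (walk x j) ≡ tail A (walk x k) → walk x j ≡ walk x k
  walk-tail x j k eq = Good.out-injective _ _ eq refl (trans (walk-label x j) (sym (walk-label x k)))

  module _ (x : Fin (Graph.#E G * 2)) where

    private module P = Period (period x)

    walk-injective : ∀ {i j : Fin (suc P.pred)} → walk x (toℕ i) ≡ walk x (toℕ j) → i ≡ j
    walk-injective eq = iter-periodic (period x) (decode-injective eq)

    walk-next : ∀ (i : Fin (suc P.pred)) → walk x (toℕ (next i)) ≡ follow (walk x (toℕ i))
    walk-next i = trans (cong decode (iter-next (period x) i)) (walk-suc x (toℕ i))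

    -- The label is constant along an orbit. Hence a repeated vertex repeats the dart by
    -- `out-injective`, an edge run both ways contradicts `turns`, and an orbit of length one would
    -- be a loop.
    faceCycle : Cycle G (suc P.pred)
    faceCycle = record
      { 2≤length         = long
      ; vertex           = λ i → tail A (walk x (toℕ i))
      ; edge             = λ i → proj₁ (walk x (toℕ i))
      ; vertex-injective = λ {i} {j} eq → walk-injective (walk-tail x (toℕ i) (toℕ j) eq)
      ; edge-injective   = λ {i} {j} eq → edge-inj i j (same-edge G _ _ eq)
      ; edge-joins       = λ i → subst (Graph.Joins G (proj₁ (walk x (toℕ i))) (tail A (walk x (toℕ i))))
          (sym (trans (cong (tail A) (walk-next i)) (follow-tail (walk x (toℕ i)))))
          (joins-dart G (walk x (toℕ i)))
      }
      where
      edge-inj : ∀ i j → walk x (toℕ i) ≡ walk x (toℕ j) ⊎ rev A (walk x (toℕ i)) ≡ walk x (toℕ j) → i ≡ j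
      edge-inj i j (inj₁ eq) = walk-injective eq
      edge-inj i j (inj₂ eq) = contradiction
        (trans (walk-label x (toℕ i)) (trans (sym (walk-label x (toℕ j))) (cong label (sym eq))))
        (Good.turns (walk x (toℕ i)) refl)

      long : 2 ≤ suc P.pred
      long = s≤s (ℕₚ.n≢0⇒n>0 λ p≡0 → no-loop G (decode x)
        (trans (cong (tail A ∘ decode) (sym (subst (λ p → iter (suc p) x ≡ x) p≡0 P.returns)))
        (trans (cong (tail A) (walk-suc x 0)) (follow-tail (decode x)))))

  module _ {n} (Faces : Enumeration Least n) where

    private module Faces = Enumeration Faces

    𝒟 : Fin n → ∃ (Cycle G)
    𝒟 k = _ , faceCycle (Faces.at k)

    faceOf : ∀ d → ∃ λ k → Faces.at k ⇝ encode d
    faceOf d with r , l , reach ← least-exists (encode d)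
             with k , refl ← Faces.complete l = k , reach

    faceOf-unique : ∀ d {k l} → Faces.at k ⇝ encode d → Faces.at l ⇝ encode d → k ≡ l
    faceOf-unique d {k} {l} p q =
      Faces.injective (least-unique (Faces.sound k) (Faces.sound l) (⇝-trans p (⇝-sym q)))

    on-face : ∀ {k} d → Faces.at k ⇝ encode d → ∃ λ i → walk (Faces.at k) (toℕ {suc (Period.pred (period (Faces.at k)))} i) ≡ d
    on-face {k} d (j , eq) with iter-wrap (Period.returns (period (Faces.at k))) j
    ... | i , i≤p , eq′ = fromℕ< (s≤s i≤p) ,
      trans (cong (walk (Faces.at k)) (toℕ-fromℕ< (s≤s i≤p)))
            (trans (cong decode (trans eq′ eq)) (decode-encode d))

    reaches : ∀ {k} j {d} → walk (Faces.at k) j ≡ d → Faces.at k ⇝ encode d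
    reaches {k} j refl = j , sym (encode-decode _)

    -- The two cycles through an edge are the orbits of its two darts. They are different orbits
    -- because `turns` gives a dart and its reverse different labels.
    covers : IsCycleDoubleCover 𝒟
    covers e = proj₁ (faceOf (e , false)) , proj₁ (faceOf (e , true)) , differ , λ k → mk⇔ (from k) (to k)
      where
      differ : proj₁ (faceOf (e , false)) ≢ proj₁ (faceOf (e , true))
      differ eq with on-face (e , false) (proj₂ (faceOf (e , false)))
                   | on-face (e , true) (subst (λ k → Faces.at k ⇝ _) (sym eq) (proj₂ (faceOf (e , true))))
      ... | i , p | j , q = Good.turns (e , false) refl (trans (cong label (sym p))
        (trans (walk-label _ (toℕ i)) (trans (sym (walk-label _ (toℕ j))) (cong label q))))

      from : ∀ k → Contains (𝒟 k) e → k ≡ proj₁ (faceOf (e , false)) ⊎ k ≡ proj₁ (faceOf (e , true))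
      from k (i , eq) with walk (Faces.at k) (toℕ i) in w
      from k (i , refl) | e , false = inj₁ (faceOf-unique (e , false) (reaches (toℕ i) w) (proj₂ (faceOf (e , false))))
      from k (i , refl) | e , true  = inj₂ (faceOf-unique (e , true) (reaches (toℕ i) w) (proj₂ (faceOf (e , true))))

      to : ∀ k → k ≡ proj₁ (faceOf (e , false)) ⊎ k ≡ proj₁ (faceOf (e , true)) → Contains (𝒟 k) e
      to k (inj₁ refl) with i , p ← on-face (e , false) (proj₂ (faceOf (e , false))) = i , cong proj₁ p
      to k (inj₂ refl) with i , p ← on-face (e , true) (proj₂ (faceOf (e , true))) = i , cong proj₁ p

    once : TraversesOnceEachWay 𝒟
    once e = traversed (e , false) , traversed (e , true)
      where
      traversed : ∀ d → ∃! _≡_ (λ k → TraversesFrom (𝒟 k) (proj₁ d) (tail A d))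
      traversed d with k , r ← faceOf d with i , p ← on-face d r =
        k , (i , cong proj₁ p , cong (tail A) p) ,
        λ (j , q , t) → faceOf-unique d r (reaches (toℕ j) (dart-≡ G _ _ q t))

  hasOrientableCDC : HasOrientableCDC G
  hasOrientableCDC = _ , 𝒟 Faces , covers Faces , once Faces
    where Faces = enumerate least?

-- Two-connectedness of cubic graphs

record Degree3 (A : Multigraph) (v : V A) : Set where
  field
    dart      : Fin 3 → Dart A
    dart-tail : ∀ i → tail A (dart i) ≡ v
    injective : Injective _≡_ _≡_ dart
    complete  : ∀ d → tail A d ≡ v → ∃ λ i → dart i ≡ d

module _ (G : Graph) where

  open Graph G using (Vertex; Edge; Incident; incident?; degree)

  private A = ⟦ G ⟧

  incident-dart : ∀ {v} e → Incident v e → ∃ λ b → tail A (e , b) ≡ v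
  incident-dart e (inj₁ p) = false , p
  incident-dart e (inj₂ p) = true , p

  dart-incident : ∀ d {v} → tail A d ≡ v → Incident v (proj₁ d)
  dart-incident (e , false) p = inj₁ p
  dart-incident (e , true)  p = inj₂ p

  degree⇒Degree3 : ∀ v → degree v ≡ 3 → Degree3 A v
  degree⇒Degree3 v eq = record
    { dart      = dart
    ; dart-tail = dart-tail
    ; injective = λ p → I.injective (cong proj₁ p)
    ; complete  = λ d p → let i , q = I.complete (dart-incident d p)
                          in i , dart-≡ G (dart i) d q (trans (dart-tail i) (sym p))
    }
    where
    module I = Enumeration (subst (Enumeration (Incident v)) eq (enumerate (incident? v)))

    dart : Fin 3 → Dart A
    dart i = I.at i , proj₁ (incident-dart (I.at i) (I.sound i))

    dart-tail : ∀ i → tail A (dart i) ≡ v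
    dart-tail i = proj₂ (incident-dart (I.at i) (I.sound i))

  Degree3⇒degree : ∀ v → Degree3 A v → degree v ≡ 3
  Degree3⇒degree v D = enumeration-unique (enumerate (incident? v)) (record
    { at        = proj₁ ∘ dart
    ; injective = λ {i} {j} p → injective (dart-≡ G (dart i) (dart j) p (trans (dart-tail i) (sym (dart-tail j))))
    ; sound     = λ i → dart-incident (dart i) (dart-tail i)
    ; complete  = λ {e} p → let b , q = incident-dart e p ; i , r = complete (e , b) q in i , cong proj₁ r
    })
    where open Degree3 D

-- Degree three and `GoodAt` only look at the darts leaving one vertex, so a bijection between such
-- darts transports both, whatever happens elsewhere.
record LocalIso (A : Multigraph) (v : V A) (B : Multigraph) (w : V B) : Set where
  field
    to         : Dart A → Dart B
    to-tail    : ∀ d → tail A d ≡ v → tail B (to d) ≡ w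
    injective  : ∀ d d′ → tail A d ≡ v → tail A d′ ≡ v → to d ≡ to d′ → d ≡ d′
    surjective : ∀ d′ → tail B d′ ≡ w → ∃ λ d → tail A d ≡ v × to d ≡ d′

module _ {A B : Multigraph} {v : V A} {w : V B} (I : LocalIso A v B w) where

  private module I = LocalIso I

  Degree3-transport : Degree3 A v → Degree3 B w
  Degree3-transport D = record
    { dart      = I.to ∘ dart
    ; dart-tail = λ i → I.to-tail (dart i) (dart-tail i)
    ; injective = λ {i} {j} p → injective (I.injective (dart i) (dart j) (dart-tail i) (dart-tail j) p)
    ; complete  = λ d′ p → let d , q , r = I.surjective d′ p ; i , s = complete d q
                           in i , trans (cong I.to s) r
    }
    where open Degree3 D

  -- The injection `f` is `id` for isomorphic graphs and `just` where a label for the rim has been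
  -- added.
  GoodAt-reflect : ∀ {K L : Set} {o ι : Dart A → K} {o′ ι′ : Dart B → L} (f : L → K) → Injective _≡_ _≡_ f →
                   (∀ d → tail A d ≡ v → o d ≡ f (o′ (I.to d))) →
                   (∀ d → tail A d ≡ v → ι d ≡ f (ι′ (I.to d))) →
                   GoodAt B o′ ι′ w → GoodAt A o ι v
  GoodAt-reflect {o′ = o′} f f-inj out in′ g = record
    { out-injective = λ d d′ p q eq → I.injective d d′ p q (out-injective (I.to d) (I.to d′)
        (I.to-tail d p) (I.to-tail d′ q) (f-inj (trans (sym (out d p)) (trans eq (out d′ q)))))
    ; in-injective  = λ d d′ p q eq → I.injective d d′ p q (in-injective (I.to d) (I.to d′)
        (I.to-tail d p) (I.to-tail d′ q) (f-inj (trans (sym (in′ d p)) (trans eq (in′ d′ q)))))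
    ; turns         = λ d p eq → turns (I.to d) (I.to-tail d p)
        (f-inj (trans (sym (out d p)) (trans eq (in′ d p))))
    ; successor     = λ d p → let e , q , r = successor (I.to d) (I.to-tail d p) ; d′ , s , t = I.surjective e q
        in d′ , s , trans (out d′ s) (trans (cong f (trans (cong o′ t) r)) (sym (in′ d p)))
    }
    where open GoodAt g

-- Connectedness is included: between components a colouring may change without a bichromatic edge.
NoBridge : Multigraph → Set
NoBridge A = ∀ (χ : V A → Bool) (f : E A) →
  (∀ e → e ≢ f → χ (src A e) ≡ χ (tgt A e)) → ∀ a b → χ a ≡ χ b

Star-const : ∀ {A B : Set} {R : A → A → Set} (χ : A → B) →
             (∀ {x y} → R x y → χ x ≡ χ y) → ∀ {u v} → Star R u v → χ u ≡ χ v
Star-const χ step = Star.fold (λ x y → χ x ≡ χ y) (λ r eq → trans (step r) eq) refl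

-- The double negation shift, valid over a finite index set. It gathers one undecided question per
-- vertex under a single double negation.
¬¬-Fin : ∀ {n} {P : Fin n → Set} → (∀ i → ¬ ¬ P i) → ¬ ¬ (∀ i → P i)
¬¬-Fin {zero}  h k = k λ ()
¬¬-Fin {suc n} h k = h zero λ p₀ → ¬¬-Fin (h ∘ suc) λ ps → k λ { zero → p₀ ; (suc i) → ps i }

¬¬-→ : ∀ {P Q : Set} → (P → ¬ ¬ Q) → ¬ ¬ (P → Q)
¬¬-→ h k = k λ p → contradiction (λ q → k λ _ → q) (h p)

-- Two of three Booleans agree. The index `k` of the possible dissenter becomes the one edge that
-- `NoBridge` exempts.
majority : (b : Fin 3 → Bool) → ∃ λ m → ∃ λ k → ∀ i → i ≢ k → b i ≡ m
majority b with b zero 𝔹.≟ b (suc zero) | b zero 𝔹.≟ b (suc (suc zero))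
... | yes p | _ = b zero , suc (suc zero) , λ
      { zero _ → refl ; (suc zero) _ → sym p ; (suc (suc zero)) ≢k → contradiction refl ≢k }
... | no _ | yes p = b zero , suc zero , λ
      { zero _ → refl ; (suc zero) ≢k → contradiction refl ≢k ; (suc (suc zero)) _ → sym p }
... | no p | no q = not (b zero) , zero , λ
      { zero ≢k → contradiction refl ≢k ; (suc zero) _ → ¬-not (p ∘ sym) ; (suc (suc zero)) _ → ¬-not (q ∘ sym) }

module _ (G : Graph) (cubic : ∀ v → Degree3 ⟦ G ⟧ v) where

  open Graph G using (Vertex; Edge; Joins; Adjacent; ConnectedOn)

  private
    A = ⟦ G ⟧
    module D {v} = Degree3 (cubic v)

  joins-const : (χ : Vertex → Bool) → ∀ {e} → χ (src A e) ≡ χ (tgt A e) → ∀ {u v} → Joins e u v → χ u ≡ χ v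
  joins-const χ eq (inj₁ (refl , refl)) = eq
  joins-const χ eq (inj₂ (refl , refl)) = sym eq

  dart-avoiding : ∀ v f → ∃ λ d → tail A d ≡ v × proj₁ d ≢ f
  dart-avoiding v f with proj₁ (D.dart {v} zero) ≟ f | proj₁ (D.dart {v} (suc zero)) ≟ f
  ... | no ≢f | _     = D.dart zero , D.dart-tail zero , ≢f
  ... | yes _ | no ≢f = D.dart (suc zero) , D.dart-tail (suc zero) , ≢f
  ... | yes p | yes q = contradiction (D.injective (dart-≡ G (D.dart zero) (D.dart (suc zero)) (trans p (sym q))
                          (trans (D.dart-tail zero) (sym (D.dart-tail (suc zero)))))) λ ()

  -- If the ends of `f` had different colours, a second edge at `src f` would lead to a vertex
  -- coloured like `src f`. Without `src f` that vertex is still joined to `tgt f`, by a walk that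
  -- cannot use `f`, so the colours agree after all.
  TwoConnected⇒NoBridge : TwoConnected G → NoBridge A
  TwoConnected⇒NoBridge (_ , connected , connected-∖) χ f same a b with χ (src A f) 𝔹.≟ χ (tgt A f)
  ... | yes eq = Star-const χ (λ (_ , _ , e , j) → joins-const χ (all e) j) (connected {a} {b} tt tt)
    where
    all : ∀ e → χ (src A e) ≡ χ (tgt A e)
    all e with e ≟ f
    ... | yes refl = eq
    ... | no ≢f    = same e ≢f
  ... | no χ≢ with dart-avoiding (src A f) f
  ... | d , t , ≢f = contradiction
          (trans (joins-const χ (same (proj₁ d) ≢f) (subst (λ v → Joins (proj₁ d) v (head A d)) t (joins-dart G d)))
                 (Star-const χ step (connected-∖ (src A f) {head A d} {tgt A f}
                    (λ eq → no-loop G d (trans t (sym eq))) (λ eq → Graph.loopless G f (sym eq)))))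
          χ≢
    where
    step : ∀ {x y} → x ≢ src A f × y ≢ src A f × Adjacent x y → χ x ≡ χ y
    step (x≢ , y≢ , e , j) = joins-const χ (same e (avoids j)) j
      where
      avoids : Joins e _ _ → e ≢ f
      avoids (inj₁ (p , _)) refl = x≢ (sym p)
      avoids (inj₂ (p , _)) refl = y≢ (sym p)

  -- The colouring to consider is reachability from `u` inside `P`. Under double negation it may be
  -- assumed decidable at all vertices at once.
  ConnectedOn-¬¬ : (P : Pred Vertex 0ℓ) →
    (∀ (χ : Vertex → Bool) → (∀ {x y} → P x × P y × Adjacent x y → χ x ≡ χ y) →
       ∀ {u v} → P u → P v → χ u ≡ χ v) →
    ¬ ¬ ConnectedOn P
  ConnectedOn-¬¬ P const k = ¬¬-Fin (λ u → ¬¬-Fin (λ v → ¬¬-→ {P u} λ pu → ¬¬-→ {P v} λ pv → joined pu pv))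
                               λ h → k λ {u} {v} → h u v
    where
    R : Vertex → Vertex → Set
    R x y = P x × P y × Adjacent x y

    R-sym : ∀ {x y} → R x y → R y x
    R-sym (p , q , e , inj₁ j) = q , p , e , inj₂ j
    R-sym (p , q , e , inj₂ j) = q , p , e , inj₁ j

    joined : ∀ {u v} → P u → P v → ¬ ¬ Star R u v
    joined {u} {v} pu pv ¬j = ¬¬-Fin (λ x → ¬¬-excluded-middle {A = Star R u x}) λ reach? →
      let χ : Vertex → Bool
          χ x = does (reach? x)
          closed : ∀ {x y} → R x y → χ x ≡ χ y
          closed {x} {y} r = does-⇔ (mk⇔ (_◅◅ (r ◅ ε)) (_◅◅ (R-sym r ◅ ε))) (reach? x) (reach? y)
      in contradiction (trans (sym (dec-true (reach? u) ε)) (trans (const χ closed pu pv) (dec-false (reach? v) ¬j))) λ ()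

  -- A cut vertex of degree three is attached to some part of the remainder by a single edge, and
  -- that edge would be a bridge.
  NoBridge⇒TwoConnected : 2 ≤ Graph.#V G → NoBridge A → ¬ ¬ TwoConnected G
  NoBridge⇒TwoConnected 2≤ nb k =
    ConnectedOn-¬¬ (λ _ → ⊤) whole λ c →
    ¬¬-Fin (λ w → ConnectedOn-¬¬ (_≢ w) (punctured w)) λ c′ →
    k (2≤ , c , c′)
    where
    whole : (χ : Vertex → Bool) → (∀ {x y} → ⊤ × ⊤ × Adjacent x y → χ x ≡ χ y) →
            ∀ {u v} → ⊤ → ⊤ → χ u ≡ χ v
    whole χ closed {u} {v} _ _ = nb χ (proj₁ (D.dart {u} zero))
      (λ e _ → closed (tt , tt , e , inj₁ (refl , refl))) u v

    -- Colouring w like the majority of its neighbours leaves at most one bichromatic edge at w.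
    punctured : ∀ w (χ : Vertex → Bool) → (∀ {x y} → x ≢ w × y ≢ w × Adjacent x y → χ x ≡ χ y) →
                ∀ {u v} → u ≢ w → v ≢ w → χ u ≡ χ v
    punctured w χ closed {u} {v} u≢ v≢ with majority (χ ∘ head A ∘ D.dart {w})
    ... | m , i , agree = trans (sym (off u≢)) (trans (nb χ′ f same u v) (off v≢))
      where
      f = proj₁ (D.dart {w} i)

      χ′ : Vertex → Bool
      χ′ x with x ≟ w
      ... | yes _ = m
      ... | no  _ = χ x

      off : ∀ {x} → x ≢ w → χ′ x ≡ χ x
      off {x} ≢w with x ≟ w
      ... | yes p = contradiction p ≢w
      ... | no  _ = refl

      at-w : ∀ d → tail A d ≡ w → proj₁ d ≢ f → χ (head A d) ≡ m
      at-w d t ≢f with D.complete d t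
      ... | j , refl = agree j λ { refl → ≢f refl }

      same : ∀ e → e ≢ f → χ′ (src A e) ≡ χ′ (tgt A e)
      same e ≢f with src A e ≟ w | tgt A e ≟ w
      ... | yes p | yes q = refl
      ... | yes p | no _  = sym (at-w (e , false) p ≢f)
      ... | no _  | yes q = at-w (e , true) q ≢f
      ... | no p  | no q  = closed (p , q , e , inj₁ (refl , refl))

-- Cycles with spokes

record Complement {I : Set} {N} (f : I → Fin N) : Set where
  field
    {size}   : ℕ
    at       : Fin size → Fin N
    from     : Fin N → I ⊎ Fin size
    to-from  : ∀ x → [ f , at ] (from x) ≡ x
    from-to  : ∀ y → from ([ f , at ] y) ≡ y

  to : I ⊎ Fin size → Fin N
  to = [ f , at ]

  outside : ∀ {x} → ¬ (∃ λ i → f i ≡ x) → ∃ λ j → at j ≡ x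
  outside {x} ∉f with from x | to-from x
  ... | inj₁ i | eq = contradiction (i , eq) ∉f
  ... | inj₂ j | eq = j , eq

  disjoint : ∀ {i j} → f i ≢ at j
  disjoint {i} {j} eq = contradiction (trans (sym (from-to (inj₁ i))) (trans (cong from eq) (from-to (inj₂ j)))) λ ()

complement : ∀ {I : Set} {N} (f : I → Fin N) → Injective _≡_ _≡_ f →
             (∀ x → Dec (∃ λ i → f i ≡ x)) → Complement f
complement {I} {N} f f-inj f? = record { at = C.at ; from = from ; to-from = to-from ; from-to = from-to }
  where
  module C = Enumeration (enumerate (λ x → ¬? (f? x)))

  from : Fin N → I ⊎ Fin _
  from x with f? x
  ... | yes (i , _) = inj₁ i
  ... | no ∉f       = inj₂ (proj₁ (C.complete ∉f))

  to-from : ∀ x → [ f , C.at ] (from x) ≡ x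
  to-from x with f? x
  ... | yes (i , eq) = eq
  ... | no ∉f        = proj₂ (C.complete ∉f)

  from-to : ∀ y → from ([ f , C.at ] y) ≡ y
  from-to (inj₁ i) with f? (f i)
  ... | yes (j , eq) = cong inj₁ (f-inj eq)
  ... | no ∉f        = contradiction (i , refl) ∉f
  from-to (inj₂ j) with f? (C.at j)
  ... | yes p  = contradiction p (C.sound j)
  ... | no ∉f  = cong inj₂ (C.injective (proj₂ (C.complete ∉f)))

record Iso (G : Graph) (A : Multigraph) : Set where
  field
    vto       : V A → Graph.Vertex G
    vfrom     : Graph.Vertex G → V A
    vto-vfrom : ∀ v → vto (vfrom v) ≡ v
    vfrom-vto : ∀ a → vfrom (vto a) ≡ a
    eto       : E A → Graph.Edge G
    efrom     : Graph.Edge G → E A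
    eto-efrom : ∀ e → eto (efrom e) ≡ e
    efrom-eto : ∀ a → efrom (eto a) ≡ a
    joins     : ∀ a → Graph.Joins G (eto a) (vto (src A a)) (vto (tgt A a))

  -- An isomorphism may reverse the arbitrary order of the ends of an edge; darts are carried across
  -- by correcting their direction accordingly.
  flipped : E A → Bool
  flipped a = [ (λ _ → false) , (λ _ → true) ] (joins a)

  dfrom : Dart ⟦ G ⟧ → Dart A
  dfrom (e , b) = efrom e , b xor flipped (efrom e)

  dto : Dart A → Dart ⟦ G ⟧
  dto (a , b) = eto a , b xor flipped a

  private
    xor-cancel : ∀ b c → (b xor c) xor c ≡ b
    xor-cancel false false = refl
    xor-cancel false true  = refl
    xor-cancel true  false = refl
    xor-cancel true  true  = refl

    not-xor : ∀ b c → not b xor c ≡ not (b xor c)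
    not-xor false false = refl
    not-xor false true  = refl
    not-xor true  false = refl
    not-xor true  true  = refl

  dfrom-rev : ∀ d → dfrom (rev ⟦ G ⟧ d) ≡ rev A (dfrom d)
  dfrom-rev (e , b) = cong (efrom e ,_) (not-xor b _)

  dto-dfrom : ∀ d → dto (dfrom d) ≡ d
  dto-dfrom (e , b) = cong₂ _,_ (eto-efrom e) (xor-cancel b _)

  dfrom-dto : ∀ d → dfrom (dto d) ≡ d
  dfrom-dto (a , b) rewrite efrom-eto a = cong (a ,_) (xor-cancel b _)

  tail-dto : ∀ d → tail ⟦ G ⟧ (dto d) ≡ vto (tail A d)
  tail-dto (a , false) with joins a
  ... | inj₁ (p , _) = p
  ... | inj₂ (_ , q) = q
  tail-dto (a , true) with joins a
  ... | inj₁ (_ , q) = q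
  ... | inj₂ (p , _) = p

  tail-dfrom : ∀ d → tail A (dfrom d) ≡ vfrom (tail ⟦ G ⟧ d)
  tail-dfrom d = trans (sym (vfrom-vto _)) (cong vfrom
    (trans (sym (tail-dto (dfrom d))) (cong (tail ⟦ G ⟧) (dto-dfrom d))))

  localIso : ∀ v → LocalIso ⟦ G ⟧ v A (vfrom v)
  localIso v = record
    { to         = dfrom
    ; to-tail    = λ d p → trans (tail-dfrom d) (cong vfrom p)
    ; injective  = λ d d′ _ _ eq → trans (sym (dto-dfrom d)) (trans (cong dto eq) (dto-dfrom d′))
    ; surjective = λ d′ p → dto d′ , trans (tail-dto d′) (trans (cong vto p) (vto-vfrom v)) , dfrom-dto d′
    }

  degree3 : (∀ v → Degree3 ⟦ G ⟧ v) → ∀ a → Degree3 A a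
  degree3 cubic a = subst (Degree3 A) (vfrom-vto a) (Degree3-transport (localIso (vto a)) (cubic (vto a)))

  labelling : FaceLabelling A → FaceLabelling ⟦ G ⟧
  labelling F = record
    { Label = Label
    ; label = label ∘ dfrom
    ; good  = λ v → GoodAt-reflect (localIso v) {o′ = label} {label ∘ rev A} id id
                      (λ _ _ → refl) (λ d _ → cong label (dfrom-rev d)) (good (vfrom v))
    }
    where open FaceLabelling F

  noBridge : NoBridge ⟦ G ⟧ → NoBridge A
  noBridge nb χ f same a b = subst₂ (λ x y → χ x ≡ χ y) (vfrom-vto a) (vfrom-vto b)
    (nb (χ ∘ vfrom) (eto f) sameG (vto a) (vto b))
    where
    sameDart : ∀ d → proj₁ d ≢ f → χ (tail A d) ≡ χ (head A d)
    sameDart (e , false) ≢f = same e ≢f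
    sameDart (e , true)  ≢f = sym (same e ≢f)

    sameG : ∀ e → e ≢ eto f → χ (vfrom (Graph.src G e)) ≡ χ (vfrom (Graph.tgt G e))
    sameG e ≢f = trans (cong χ (sym (tail-dfrom (e , false))))
      (trans (sameDart (dfrom (e , false)) (λ eq → ≢f (trans (sym (eto-efrom e)) (cong eto eq))))
             (cong χ (trans (cong (tail A) (sym (dfrom-rev (e , false)))) (tail-dfrom (e , true)))))

  noLoop : ∀ a → src A a ≢ tgt A a
  noLoop a eq with joins a
  ... | inj₁ (p , q) = Graph.loopless G (eto a) (trans p (trans (cong vto eq) (sym q)))
  ... | inj₂ (p , q) = Graph.loopless G (eto a) (trans p (trans (cong vto (sym eq)) (sym q)))

-- A K-cycle (the rim) with one spoke from each rim vertex i to the vertex foot i of an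
-- arbitrary outer graph.
record Frame (K : ℕ) : Set where
  field
    #outer #rest     : ℕ
    foot             : Fin K → Fin #outer
    restSrc restTgt  : Fin #rest → Fin #outer

pattern core i  = inj₁ i
pattern outer x = inj₂ x

pattern rim i   = inj₁ (inj₁ i)
pattern spoke i = inj₁ (inj₂ i)
pattern rest j  = inj₂ j

module _ {K} (F : Frame K) where

  open Frame F

  -- The sum types build in that no spoke is a chord of the rim. Distinct spokes may still share a
  -- foot.
  framed : Multigraph
  framed = record
    { V   = Fin K ⊎ Fin #outer
    ; E   = (Fin K ⊎ Fin K) ⊎ Fin #rest
    ; src = λ { (rim i) → core i ; (spoke i) → core i ; (rest j) → outer (restSrc j) }
    ; tgt = λ { (rim i) → core (next i) ; (spoke i) → outer (foot i) ; (rest j) → outer (restTgt j) }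
    }

third : ∀ (i j : Fin 3) → i ≢ j → ∃ λ k → k ≢ i × k ≢ j × (∀ l → l ≡ i ⊎ l ≡ j ⊎ l ≡ k)
third zero zero ≢ = contradiction refl ≢
third zero (suc zero) _ = suc (suc zero) , (λ ()) , (λ ()) ,
  λ { zero → inj₁ refl ; (suc zero) → inj₂ (inj₁ refl) ; (suc (suc zero)) → inj₂ (inj₂ refl) }
third zero (suc (suc zero)) _ = suc zero , (λ ()) , (λ ()) ,
  λ { zero → inj₁ refl ; (suc zero) → inj₂ (inj₂ refl) ; (suc (suc zero)) → inj₂ (inj₁ refl) }
third (suc zero) zero _ = suc (suc zero) , (λ ()) , (λ ()) ,
  λ { zero → inj₂ (inj₁ refl) ; (suc zero) → inj₁ refl ; (suc (suc zero)) → inj₂ (inj₂ refl) }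
third (suc zero) (suc zero) ≢ = contradiction refl ≢
third (suc zero) (suc (suc zero)) _ = zero , (λ ()) , (λ ()) ,
  λ { zero → inj₂ (inj₂ refl) ; (suc zero) → inj₁ refl ; (suc (suc zero)) → inj₂ (inj₁ refl) }
third (suc (suc zero)) zero _ = suc zero , (λ ()) , (λ ()) ,
  λ { zero → inj₂ (inj₁ refl) ; (suc zero) → inj₂ (inj₂ refl) ; (suc (suc zero)) → inj₁ refl }
third (suc (suc zero)) (suc zero) _ = zero , (λ ()) , (λ ()) ,
  λ { zero → inj₂ (inj₂ refl) ; (suc zero) → inj₂ (inj₁ refl) ; (suc (suc zero)) → inj₁ refl }
third (suc (suc zero)) (suc (suc zero)) ≢ = contradiction refl ≢

third-dart : ∀ {A v} → Degree3 A v → ∀ a b → tail A a ≡ v → tail A b ≡ v → a ≢ b →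
  ∃ λ c → tail A c ≡ v × c ≢ a × c ≢ b × (∀ d → tail A d ≡ v → d ≡ a ⊎ d ≡ b ⊎ d ≡ c)
third-dart D a b p q ≢ with Degree3.complete D a p | Degree3.complete D b q
... | i , refl | j , refl with third i j (≢ ∘ cong (Degree3.dart D))
... | k , k≢i , k≢j , all = Degree3.dart D k , Degree3.dart-tail D k ,
      k≢i ∘ Degree3.injective D , k≢j ∘ Degree3.injective D , cover
  where
  cover : ∀ d → tail _ d ≡ _ → _
  cover d r with Degree3.complete D d r
  ... | l , refl with all l
  ... | inj₁ refl        = inj₁ refl
  ... | inj₂ (inj₁ refl) = inj₂ (inj₁ refl)
  ... | inj₂ (inj₂ refl) = inj₂ (inj₂ refl)

module Legs (G : Graph) (cubic : ∀ v → Degree3 ⟦ G ⟧ v) {K} (C : Cycle G K) where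

  private
    A = ⟦ G ⟧
    module C = Cycle C

  abstract
    onward : ∀ i → ∃ λ d → proj₁ d ≡ C.edge i × tail A d ≡ C.vertex i × head A d ≡ C.vertex (next i)
    onward i = dart-from G (C.edge-joins i)

    back : ∀ i → ∃ λ d → proj₁ d ≡ C.edge (prev i) × tail A d ≡ C.vertex i
    back i with onward (prev i)
    ... | d , p , _ , q = rev A d , p , trans q (cong C.vertex (next-prev i))

  edges-differ : ∀ i → C.edge i ≢ C.edge (prev i)
  edges-differ i eq = next-≢ C.2≤length i (trans (cong next (C.edge-injective eq)) (next-prev i))

  thirds : ∀ i → ∃ λ c → tail A c ≡ C.vertex i × c ≢ proj₁ (onward i) × c ≢ proj₁ (back i) ×
    (∀ d → tail A d ≡ C.vertex i → d ≡ proj₁ (onward i) ⊎ d ≡ proj₁ (back i) ⊎ d ≡ c)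
  thirds i with onward i | back i
  ... | a , p , q , _ | b , r , s =
    third-dart (cubic (C.vertex i)) a b q s (λ eq → edges-differ i (trans (sym p) (trans (cong proj₁ eq) r)))

  leg : Fin K → Dart A
  leg i = proj₁ (thirds i)

  leg-tail : ∀ i → tail A (leg i) ≡ C.vertex i
  leg-tail i = proj₁ (proj₂ (thirds i))

  leg≢edge : ∀ i → proj₁ (leg i) ≢ C.edge i
  leg≢edge i eq with onward i | thirds i
  ... | a , p , q , _ | c , t , ≢a , _ = ≢a (dart-≡ G c a (trans eq (sym p)) (trans t (sym q)))

  leg≢edge-prev : ∀ i → proj₁ (leg i) ≢ C.edge (prev i)
  leg≢edge-prev i eq with back i | thirds i
  ... | b , p , q | c , t , _ , ≢b , _ = ≢b (dart-≡ G c b (trans eq (sym p)) (trans t (sym q)))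

  leg-complete : ∀ i d → tail A d ≡ C.vertex i →
                 proj₁ d ≡ C.edge i ⊎ proj₁ d ≡ C.edge (prev i) ⊎ d ≡ leg i
  leg-complete i d t with onward i | back i | thirds i
  ... | a , p , _ | b , q , _ | c , _ , _ , _ , all with all d t
  ... | inj₁ refl        = inj₁ p
  ... | inj₂ (inj₁ refl) = inj₂ (inj₁ q)
  ... | inj₂ (inj₂ refl) = inj₂ (inj₂ refl)

  cycle-end : ∀ i d → proj₁ d ≡ C.edge i → ∃ λ j → C.vertex j ≡ head A d
  cycle-end i d eq with onward i
  ... | a , p , q , r with same-edge G a d (trans p (sym eq))
  ... | inj₁ refl = next i , sym r
  ... | inj₂ refl = i , sym (trans (cong (tail A) (Multigraph.rev-rev A a)) q)

  module Outward (outward : ∀ i j → C.vertex j ≢ head A (leg i)) where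

    inner : Fin K ⊎ Fin K → Graph.Edge G
    inner = [ C.edge , proj₁ ∘ leg ]

    -- A leg that coincides with a rim edge, or with a leg from another vertex, ends on the cycle,
    -- against `outward`.
    inner-injective : Injective _≡_ _≡_ inner
    inner-injective {inj₁ i} {inj₁ j} eq = cong inj₁ (C.edge-injective eq)
    inner-injective {inj₁ i} {inj₂ j} eq with cycle-end i (leg j) (sym eq)
    ... | k , p = contradiction p (outward j k)
    inner-injective {inj₂ i} {inj₁ j} eq with cycle-end j (leg i) eq
    ... | k , p = contradiction p (outward i k)
    inner-injective {inj₂ i} {inj₂ j} eq with same-edge G (leg i) (leg j) eq
    ... | inj₁ p = cong inj₂ (C.vertex-injective
                     (trans (sym (leg-tail i)) (trans (cong (tail A) p) (leg-tail j))))
    ... | inj₂ p = contradiction (sym (trans (cong (tail A) p) (leg-tail j))) (outward i j)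

    private
      vertices : Complement C.vertex
      vertices = complement C.vertex C.vertex-injective λ v → any? λ i → C.vertex i ≟ v

      edges : Complement inner
      edges = complement inner inner-injective λ e →
        map′ [ (λ (i , p) → inj₁ i , p) , (λ (i , p) → inj₂ i , p) ]
             (λ { (inj₁ i , p) → inj₁ (i , p) ; (inj₂ i , p) → inj₂ (i , p) })
             (any? (λ i → C.edge i ≟ e) ⊎-dec any? (λ i → proj₁ (leg i) ≟ e))

      module VC = Complement vertices
      module EC = Complement edges

    rest-outside : ∀ j b → ¬ (∃ λ i → C.vertex i ≡ tail A (EC.at j , b))
    rest-outside j b (i , p) with leg-complete i (EC.at j , b) (sym p)
    ... | inj₁ q        = EC.disjoint {inj₁ i} (sym q)
    ... | inj₂ (inj₁ q) = EC.disjoint {inj₁ (prev i)} (sym q)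
    ... | inj₂ (inj₂ q) = EC.disjoint {inj₂ i} (sym (cong proj₁ q))

    frame : Frame K
    frame = record
      { foot    = λ i → proj₁ (VC.outside (λ (j , p) → outward i j p))
      ; restSrc = λ j → proj₁ (VC.outside (rest-outside j false))
      ; restTgt = λ j → proj₁ (VC.outside (rest-outside j true))
      }

    iso : Iso G (framed frame)
    iso = record
      { vto = VC.to ; vfrom = VC.from ; vto-vfrom = VC.to-from ; vfrom-vto = VC.from-to
      ; eto = EC.to ; efrom = EC.from ; eto-efrom = EC.to-from ; efrom-eto = EC.from-to
      ; joins = λ
          { (rim i)   → C.edge-joins i
          ; (spoke i) → subst₂ (Graph.Joins G (proj₁ (leg i))) (leg-tail i)
                          (sym (proj₂ (VC.outside (λ (j , p) → outward i j p)))) (joins-dart G (leg i))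
          ; (rest j)  → inj₁ ( sym (proj₂ (VC.outside (rest-outside j false)))
                             , sym (proj₂ (VC.outside (rest-outside j true)))) }
      }

-- Extending labellings over the rim

-- A derangement of three labels is a 3-cycle, so goodness at a cubic vertex amounts to a cyclic
-- order of its darts in which each incoming face leaves along the next one.
rotation-good : ∀ {A v} {L : Set} {o ι : Dart A → L} a b c →
  tail A a ≡ v → tail A b ≡ v → tail A c ≡ v →
  (∀ d → tail A d ≡ v → d ≡ a ⊎ d ≡ b ⊎ d ≡ c) →
  o a ≢ o b → o b ≢ o c → o c ≢ o a →
  ι a ≡ o b → ι b ≡ o c → ι c ≡ o a → GoodAt A o ι v
rotation-good {A} {v} {L} {o} {ι} a b c ta tb tc all ab bc ca ιa ιb ιc = record
  { out-injective = λ d d′ p q → out d d′ (all d p) (all d′ q)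
  ; in-injective  = λ d d′ p q → in′ d d′ (all d p) (all d′ q)
  ; turns         = λ d p → turn d (all d p)
  ; successor     = λ d p → succ d (all d p)
  }
  where
  Listed : Dart A → Set
  Listed d = d ≡ a ⊎ d ≡ b ⊎ d ≡ c

  out : ∀ d d′ → Listed d → Listed d′ → o d ≡ o d′ → d ≡ d′
  out d d′ (inj₁ refl)        (inj₁ refl)        eq = refl
  out d d′ (inj₁ refl)        (inj₂ (inj₁ refl)) eq = contradiction eq ab
  out d d′ (inj₁ refl)        (inj₂ (inj₂ refl)) eq = contradiction (sym eq) ca
  out d d′ (inj₂ (inj₁ refl)) (inj₁ refl)        eq = contradiction (sym eq) ab
  out d d′ (inj₂ (inj₁ refl)) (inj₂ (inj₁ refl)) eq = refl
  out d d′ (inj₂ (inj₁ refl)) (inj₂ (inj₂ refl)) eq = contradiction eq bc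
  out d d′ (inj₂ (inj₂ refl)) (inj₁ refl)        eq = contradiction eq ca
  out d d′ (inj₂ (inj₂ refl)) (inj₂ (inj₁ refl)) eq = contradiction (sym eq) bc
  out d d′ (inj₂ (inj₂ refl)) (inj₂ (inj₂ refl)) eq = refl

  in′ : ∀ d d′ → Listed d → Listed d′ → ι d ≡ ι d′ → d ≡ d′
  in′ d d′ (inj₁ refl)        (inj₁ refl)        eq = refl
  in′ d d′ (inj₁ refl)        (inj₂ (inj₁ refl)) eq = contradiction (trans (sym ιa) (trans eq ιb)) bc
  in′ d d′ (inj₁ refl)        (inj₂ (inj₂ refl)) eq = contradiction (trans (sym ιc) (trans (sym eq) ιa)) ab
  in′ d d′ (inj₂ (inj₁ refl)) (inj₁ refl)        eq = contradiction (trans (sym ιa) (trans (sym eq) ιb)) bc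
  in′ d d′ (inj₂ (inj₁ refl)) (inj₂ (inj₁ refl)) eq = refl
  in′ d d′ (inj₂ (inj₁ refl)) (inj₂ (inj₂ refl)) eq = contradiction (trans (sym ιb) (trans eq ιc)) ca
  in′ d d′ (inj₂ (inj₂ refl)) (inj₁ refl)        eq = contradiction (trans (sym ιc) (trans eq ιa)) ab
  in′ d d′ (inj₂ (inj₂ refl)) (inj₂ (inj₁ refl)) eq = contradiction (trans (sym ιb) (trans (sym eq) ιc)) ca
  in′ d d′ (inj₂ (inj₂ refl)) (inj₂ (inj₂ refl)) eq = refl

  turn : ∀ d → Listed d → o d ≢ ι d
  turn d (inj₁ refl)        eq = ab (trans eq ιa)
  turn d (inj₂ (inj₁ refl)) eq = bc (trans eq ιb)
  turn d (inj₂ (inj₂ refl)) eq = ca (trans eq ιc)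

  succ : ∀ d → Listed d → ∃ λ d′ → tail A d′ ≡ v × o d′ ≡ ι d
  succ d (inj₁ refl)        = b , tb , sym ιa
  succ d (inj₂ (inj₁ refl)) = c , tc , sym ιb
  succ d (inj₂ (inj₂ refl)) = a , ta , sym ιc

-- Labels of the rim darts, forward and backward, that complete given labels arriving at and
-- departing from the rim along the spokes.
record RimLabels {K} {L : Set} (arrive depart : Fin K → L) : Set where
  field
    forward backward : Fin K → L
    distinct : ∀ i → forward i ≢ backward (prev i) × backward (prev i) ≢ depart i × depart i ≢ forward i
    -- The two cyclic orders at a rim vertex. In the first the face arriving by the spoke turns
    -- forward and the backward face passes straight on; the second is the mirror image.
    rotation : ∀ i →
        (backward i ≡ backward (prev i) × forward (prev i) ≡ depart i × arrive i ≡ forward i)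
      ⊎ (backward i ≡ depart i × arrive i ≡ backward (prev i) × forward (prev i) ≡ forward i)

module _ {K} {L : Set} (arrive depart : Fin K → L) (differ : ∀ i → arrive i ≢ depart i) where

  -- The rim itself becomes a face with the new label nothing.
  rimFace⁻ : (∀ i → arrive i ≡ depart (next i)) → RimLabels (just ∘ arrive) (just ∘ depart)
  rimFace⁻ eq = record
    { forward  = just ∘ arrive
    ; backward = λ _ → nothing
    ; distinct = λ i → (λ ()) , (λ ()) , λ p → differ i (just-injective (sym p))
    ; rotation = λ i → inj₁ (refl , cong just (trans (eq (prev i)) (cong depart (next-prev i))) , refl)
    }

  rimFace⁺ : (∀ i → arrive (next i) ≡ depart i) → RimLabels (just ∘ arrive) (just ∘ depart)
  rimFace⁺ eq = record
    { forward  = λ _ → nothing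
    ; backward = just ∘ depart
    ; distinct = λ i → (λ ()) , (λ p → differ i (just-injective (trans (cong just (arrive-prev i)) p))) , λ ()
    ; rotation = λ i → inj₂ (refl , cong just (arrive-prev i) , refl)
    }
    where
    arrive-prev : ∀ i → arrive i ≡ depart (prev i)
    arrive-prev i = trans (cong arrive (sym (next-prev i))) (eq (prev i))

-- B arises from framed F by replacing the rim; every spoke turns into the dart of B
-- that leaves its foot.
record Replacement {K} (F : Frame K) (B : Multigraph) : Set where
  open Frame F
  field
    place           : Fin #outer → V B
    place-injective : Injective _≡_ _≡_ place
    stub            : Fin K → Dart B
    stub-tail       : ∀ i → tail B (stub i) ≡ place (foot i)
    stub-injective  : Injective _≡_ _≡_ stub
    old             : Fin #rest → E B
    old-src         : ∀ j → src B (old j) ≡ place (restSrc j)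
    old-tgt         : ∀ j → tgt B (old j) ≡ place (restTgt j)
    old-injective   : Injective _≡_ _≡_ old
    stub≢old        : ∀ i j → proj₁ (stub i) ≢ old j
    covered         : ∀ d x → tail B d ≡ place x → (∃ λ i → stub i ≡ d) ⊎ (∃ λ j → old j ≡ proj₁ d)

  private
    A = framed F

    to : Dart A → Dart B
    -- Only darts leaving outer vertices matter here, so the values on rim darts and on darts from
    -- the rim into the spokes are fillers.
    to (rim i , b)       = stub i
    to (spoke i , false) = rev B (stub i)
    to (spoke i , true)  = stub i
    to (rest j , b)      = old j , b

    to-tail : ∀ {x} d → tail A d ≡ outer x → tail B (to d) ≡ place x
    to-tail (spoke i , true) refl = stub-tail i
    to-tail (rest j , false) refl = old-src j
    to-tail (rest j , true)  refl = old-tgt j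
    to-tail (spoke i , false) ()
    to-tail (rim i , false) ()
    to-tail (rim i , true) ()

    to-injective : ∀ {x} d d′ → tail A d ≡ outer x → tail A d′ ≡ outer x → to d ≡ to d′ → d ≡ d′
    to-injective (spoke i , true) (spoke j , true) _ _ eq = cong (λ i → spoke i , true) (stub-injective eq)
    to-injective (spoke i , true) (rest j , b)     _ _ eq = contradiction (cong proj₁ eq) (stub≢old i j)
    to-injective (rest j , b) (spoke i , true)     _ _ eq = contradiction (cong proj₁ (sym eq)) (stub≢old i j)
    to-injective (rest j , b) (rest k , c)         _ _ eq = cong₂ _,_ (cong inj₂ (old-injective (cong proj₁ eq))) (cong proj₂ eq)
    to-injective (rim i , false) _ ()
    to-injective (rim i , true) _ ()
    to-injective (spoke i , false) _ ()
    to-injective _ (rim i , false) _ ()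
    to-injective _ (rim i , true) _ ()
    to-injective _ (spoke i , false) _ ()

    to-surjective : ∀ {x} d′ → tail B d′ ≡ place x → ∃ λ d → tail A d ≡ outer x × to d ≡ d′
    to-surjective {x} d′ p with covered d′ x p
    ... | inj₁ (i , refl) = (spoke i , true) , cong inj₂ (place-injective (trans (sym (stub-tail i)) p)) , refl
    to-surjective {x} (_ , false) p | inj₂ (j , refl) =
      (rest j , false) , cong inj₂ (place-injective (trans (sym (old-src j)) p)) , refl
    to-surjective {x} (_ , true) p | inj₂ (j , refl) =
      (rest j , true) , cong inj₂ (place-injective (trans (sym (old-tgt j)) p)) , refl

  localIso : ∀ x → LocalIso A (outer x) B (place x)
  localIso x = record { to = to ; to-tail = to-tail ; injective = to-injective ; surjective = to-surjective }

  module _ {L : Set} {o ι : Dart B → L} (good : ∀ x → GoodAt B o ι (place x))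
           (old-const : ∀ j b → ι (old j , b) ≡ o (old j , not b)) where

    arrive depart : Fin K → L
    arrive i = o (stub i)
    depart i = ι (stub i)

    arrive≢depart : ∀ i → arrive i ≢ depart i
    arrive≢depart i = GoodAt.turns (good (foot i)) (stub i) (stub-tail i)

    -- Labels off the rim are copied from `B`, and `Maybe` makes room for one new face. Only along
    -- old edges do the labels seen at both ends have to agree; on the replaced edges they may
    -- differ, which is what allows a face to be cut there.
    extend : RimLabels (just ∘ arrive) (just ∘ depart) → FaceLabelling A
    extend R = record { Label = Maybe L ; label = label ; good = good′ }
      where
      open RimLabels R

      label : Dart A → Maybe L
      label (rim i , false)   = forward i
      label (rim i , true)    = backward i
      label (spoke i , false) = just (depart i)
      label (spoke i , true)  = just (arrive i)
      label (rest j , b)      = just (o (old j , b))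

      at-core : ∀ i d → tail A d ≡ core i →
                d ≡ (rim i , false) ⊎ d ≡ (rim (prev i) , true) ⊎ d ≡ (spoke i , false)
      at-core i (rim j , false)   refl = inj₁ refl
      at-core i (rim j , true)    refl = inj₂ (inj₁ (cong (λ k → rim k , true) (sym (prev-next j))))
      at-core i (spoke j , false) refl = inj₂ (inj₂ refl)
      at-core i (rest j , false) ()
      at-core i (rest j , true) ()
      at-core i (spoke j , true) ()

      at-core′ : ∀ i d → tail A d ≡ core i →
                d ≡ (rim i , false) ⊎ d ≡ (spoke i , false) ⊎ d ≡ (rim (prev i) , true)
      at-core′ i d p with at-core i d p
      ... | inj₁ q        = inj₁ q
      ... | inj₂ (inj₁ q) = inj₂ (inj₂ q)
      ... | inj₂ (inj₂ q) = inj₂ (inj₁ q)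

      good′ : ∀ v → GoodAt A label (label ∘ rev A) v
      good′ (core i) with distinct i | rotation i
      ... | ab , bc , ca | inj₁ (p , q , r) = rotation-good (rim i , false) (rim (prev i) , true) (spoke i , false)
            refl (cong inj₁ (next-prev i)) refl (at-core i) ab bc ca p q r
      ... | ab , bc , ca | inj₂ (p , q , r) = rotation-good (rim i , false) (spoke i , false) (rim (prev i) , true)
            refl refl (cong inj₁ (next-prev i)) (at-core′ i) (ca ∘ sym) (bc ∘ sym) (ab ∘ sym) p q r
      good′ (outer x) = GoodAt-reflect (localIso x) {o′ = o} {ι} just just-injective out in′ (good x)
        where
        out : ∀ d → tail A d ≡ outer x → label d ≡ just (o (to d))
        out (spoke i , true) _ = refl
        out (rest j , b)     _ = refl
        out (rim i , false) ()
        out (rim i , true) ()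
        out (spoke i , false) ()

        in′ : ∀ d → tail A d ≡ outer x → label (rev A d) ≡ just (ι (to d))
        in′ (spoke i , true) _ = refl
        in′ (rest j , b)     _ = cong just (sym (old-const j b))
        in′ (rim i , false) ()
        in′ (rim i , true) ()
        in′ (spoke i , false) ()

-- Minors and minimal counterexamples

Linked : (A : Multigraph) → V A → V A → Set
Linked A x y = ∃ λ e → (src A e ≡ x × tgt A e ≡ y) ⊎ (src A e ≡ y × tgt A e ≡ x)

-- The reductions delete edges and contract, but delete no vertex; so `branch` is total, and branch
-- sets are connected by walks to a chosen root.
record MinorMap (A B : Multigraph) : Set where
  field
    branch         : V A → V B
    root           : V B → V A
    branch-root    : ∀ x → branch (root x) ≡ x
    path           : ∀ v → Star (λ x y → branch x ≡ branch y × Linked A x y) v (root (branch v))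
    edge           : E B → E A
    edge-injective : Injective _≡_ _≡_ edge
    ends           : ∀ e → (branch (src A (edge e)) ≡ src B e × branch (tgt A (edge e)) ≡ tgt B e)
                         ⊎ (branch (src A (edge e)) ≡ tgt B e × branch (tgt A (edge e)) ≡ src B e)

module _ {G H : Graph} {A : Multigraph} (I : Iso G A) (M : MinorMap A ⟦ H ⟧) where

  private
    module I = Iso I
    open MinorMap M

  minor : H ≼ G
  minor = record
    { branch           = β
    ; branch-nonempty  = λ x → I.vto (root x) , cong just (trans (cong branch (I.vfrom-vto _)) (branch-root x))
    ; branch-connected = λ x {u} {v} p q → to-root p ◅◅ Star.reverse (λ {a} {b} → R-sym {x} {a} {b}) (to-root q)
    ; edge             = I.eto ∘ edge
    ; edge-injective   = λ {e} {e′} eq → edge-injective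
        (trans (sym (I.efrom-eto _)) (trans (cong I.efrom eq) (I.efrom-eto _)))
    ; edge-joins       = joins
    }
    where
    β : Graph.Vertex G → Maybe (Graph.Vertex H)
    β v = just (branch (I.vfrom v))

    R : Graph.Vertex H → Graph.Vertex G → Graph.Vertex G → Set
    R x a b = β a ≡ just x × β b ≡ just x × Graph.Adjacent G a b

    R-sym : ∀ {x a b} → R x a b → R x b a
    R-sym (p , q , e , inj₁ j) = q , p , e , inj₂ j
    R-sym (p , q , e , inj₂ j) = q , p , e , inj₁ j

    swap-joins : ∀ {e u v} → Graph.Joins G e u v → Graph.Joins G e v u
    swap-joins (inj₁ j) = inj₂ j
    swap-joins (inj₂ j) = inj₁ j

    adjacent : ∀ {x y} → Linked A x y → Graph.Adjacent G (I.vto x) (I.vto y)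
    adjacent (e , inj₁ (refl , refl)) = I.eto e , I.joins e
    adjacent (e , inj₂ (refl , refl)) = I.eto e , swap-joins (I.joins e)

    inBranch : ∀ {x y z} → branch y ≡ x → Star (λ x y → branch x ≡ branch y × Linked A x y) y z →
               Star (R x) (I.vto y) (I.vto z)
    inBranch p ε = ε
    inBranch p ((eq , l) ◅ s) =
      (cong just (trans (cong branch (I.vfrom-vto _)) p) ,
       cong just (trans (cong branch (I.vfrom-vto _)) (trans (sym eq) p)) , adjacent l) ◅ inBranch (trans (sym eq) p) s

    to-root : ∀ {x v} → β v ≡ just x → Star (R x) v (I.vto (root x))
    to-root {x} {v} refl = subst (λ a → Star (R x) a (I.vto (root x))) (I.vto-vfrom v)
      (inBranch refl (path (I.vfrom v)))

    joins : ∀ e → ∃₂ λ u v → Graph.Joins G (I.eto (edge e)) u v ×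
                    β u ≡ just (Graph.src H e) × β v ≡ just (Graph.tgt H e)
    joins e with ends e
    ... | inj₁ (p , q) = _ , _ , I.joins (edge e) ,
          cong just (trans (cong branch (I.vfrom-vto _)) p) , cong just (trans (cong branch (I.vfrom-vto _)) q)
    ... | inj₂ (p , q) = _ , _ , swap-joins (I.joins (edge e)) ,
          cong just (trans (cong branch (I.vfrom-vto _)) q) , cong just (trans (cong branch (I.vfrom-vto _)) p)

  fewer-edges : ∀ {a} → (∀ e → edge e ≢ a) → Graph.#E H < Graph.#E G
  fewer-edges {a} missed = injective⇒≤ {f = f} f-injective
    where
    f : Fin (suc (Graph.#E H)) → Graph.Edge G
    f zero    = I.eto a
    f (suc e) = I.eto (edge e)

    eto-injective : ∀ {a a′} → I.eto a ≡ I.eto a′ → a ≡ a′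
    eto-injective {a} {a′} eq = trans (sym (I.efrom-eto a)) (trans (cong I.efrom eq) (I.efrom-eto a′))

    f-injective : Injective _≡_ _≡_ f
    f-injective {zero}  {zero}  _  = refl
    f-injective {zero}  {suc e} eq = contradiction (sym (eto-injective eq)) (missed e)
    f-injective {suc e} {zero}  eq = contradiction (eto-injective eq) (missed e)
    f-injective {suc e} {suc e′} eq = cong suc (edge-injective (eto-injective eq))

-- The class has disappeared: being closed under minors, it contains every `H` that `minimal` speaks
-- of. The choice of `G` compares it with graphs that have no cover, which is why `minimal` ends in
-- a double negation.
record Critical (G : Graph) : Set where
  field
    cubic     : ∀ v → Degree3 ⟦ G ⟧ v
    bridgeless : NoBridge ⟦ G ⟧
    no-CDC    : ¬ HasOrientableCDC G
    minimal   : ∀ H → 𝒞₂ H → H ≼ G → Graph.#E H < Graph.#E G → ¬ ¬ HasOrientableCDC H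

-- The shape common to all three reductions: the goal `⊥` absorbs both the double negation on
-- 2-connectedness of `H` and the one on its cover.
irreducible : ∀ {G A} → Critical G → Iso G A → (H : Graph) (M : MinorMap A ⟦ H ⟧) →
  ∀ {a} → (∀ e → MinorMap.edge M e ≢ a) → 2 ≤ Graph.#V H → (∀ v → Degree3 ⟦ H ⟧ v) → NoBridge ⟦ H ⟧ →
  (HasOrientableCDC H → FaceLabelling A) → ⊥
irreducible {G} c I H M missed 2≤ cubic nb extend = NoBridge⇒TwoConnected H cubic 2≤ nb λ two →
  minimal H (two , λ v → Degree3⇒degree H v (cubic v)) (minor I M) (fewer-edges {H = H} I M missed) λ cdc →
  no-CDC (CDCFromLabelling.hasOrientableCDC G (Iso.labelling I (extend cdc)))
  where open Critical c using (minimal; no-CDC)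

-- Digons, triangles and squares

2≤-distinct : ∀ {n} {x y : Fin n} → x ≢ y → 2 ≤ n
2≤-distinct {suc zero}    {zero} {zero} x≢y = contradiction refl x≢y
2≤-distinct {suc (suc _)} _                 = s≤s (s≤s z≤n)

module Framed {K} (F : Frame (suc K)) (bridgeless : NoBridge (framed F)) (cubic : ∀ v → Degree3 (framed F) v)
              (noLoop : ∀ e → src (framed F) e ≢ tgt (framed F) e) where

  open Frame F

  private A = framed F

  -- With the rim painted in the single colour `c`, no rim edge is bichromatic, and bridgelessness
  -- of the whole graph speaks about the outer graph and the spokes alone.
  paint-const : ∀ (χ : Fin #outer → Bool) c f →
    (∀ i → spoke i ≢ f → c ≡ χ (foot i)) →
    (∀ j → rest j ≢ f → χ (restSrc j) ≡ χ (restTgt j)) →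
    ∀ x → c ≡ χ x
  paint-const χ c f spokes rests x = bridgeless [ (λ _ → c) , χ ] f
    (λ { (rim i) _ → refl ; (spoke i) → spokes i ; (rest j) → rests j }) (core zero) (outer x)

  rest-loopless : ∀ j → restSrc j ≢ restTgt j
  rest-loopless j eq = noLoop (rest j) (cong inj₂ eq)

  indicator : Fin #outer → Fin #outer → Bool
  indicator x y = does (y ≟ x)

  -- other is the only further edge at the common foot of spokes i and j.
  record SharedFoot (i j : Fin (suc K)) : Set where
    field
      other    : E A
      spoke-i  : spoke i ≢ other
      spoke-j  : spoke j ≢ other
      isolated : ∀ l → rest l ≢ other → indicator (foot i) (restSrc l) ≡ indicator (foot i) (restTgt l)
      incident : (∃ λ k → other ≡ spoke k × foot k ≡ foot i)
               ⊎ (∃ λ l → other ≡ rest l × (restSrc l ≡ foot i ⊎ restTgt l ≡ foot i))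
      only     : ∀ k → foot k ≡ foot i → k ≡ i ⊎ k ≡ j ⊎ spoke k ≡ other

  sharedFoot : ∀ i j → i ≢ j → foot i ≡ foot j → SharedFoot i j
  sharedFoot i j i≢j eq
    with third-dart (cubic (outer (foot i))) (spoke i , true) (spoke j , true) refl (cong inj₂ (sym eq))
           (λ p → i≢j (inj₂-injective (inj₁-injective (cong proj₁ p))))
  ... | (e , b) , t , ≢i , ≢j , all = record
    { other    = e
    ; spoke-i  = λ p → ≢i (spoke-dart p t)
    ; spoke-j  = λ p → ≢j (spoke-dart p t)
    ; isolated = isolated
    ; incident = incident e b t
    ; only     = λ k p → only k (all (spoke k , true) (cong inj₂ p))
    }
    where
    spoke-dart : ∀ {k e b x} → spoke k ≡ e → tail A (e , b) ≡ outer x → (e , b) ≡ (spoke k , true)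
    spoke-dart {b = true}  refl _ = refl
    spoke-dart {b = false} refl ()

    at-foot : ∀ l b → tail A (rest l , b) ≡ outer (foot i) → rest l ≡ e
    at-foot l b p with all (rest l , b) p
    ... | inj₂ (inj₂ q) = cong proj₁ q

    isolated : ∀ l → rest l ≢ e → indicator (foot i) (restSrc l) ≡ indicator (foot i) (restTgt l)
    isolated l ≢e = trans (dec-false (restSrc l ≟ foot i) (λ p → ≢e (at-foot l false (cong inj₂ p))))
                     (sym (dec-false (restTgt l ≟ foot i) (λ p → ≢e (at-foot l true (cong inj₂ p)))))

    incident : ∀ e b → tail A (e , b) ≡ outer (foot i) →
               (∃ λ k → e ≡ spoke k × foot k ≡ foot i)
             ⊎ (∃ λ l → e ≡ rest l × (restSrc l ≡ foot i ⊎ restTgt l ≡ foot i))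
    incident (spoke k) true  p = inj₁ (k , refl , inj₂-injective p)
    incident (rest l)  false p = inj₂ (l , refl , inj₁ (inj₂-injective p))
    incident (rest l)  true  p = inj₂ (l , refl , inj₂ (inj₂-injective p))
    incident (rim _)   false ()
    incident (rim _)   true  ()
    incident (spoke _) false ()

    only : ∀ k → (spoke k , true) ≡ (spoke i , true) ⊎ (spoke k , true) ≡ (spoke j , true) ⊎ (spoke k , true) ≡ (e , b) →
           k ≡ i ⊎ k ≡ j ⊎ spoke k ≡ e
    only k (inj₁ p)        = inj₁ (inj₂-injective (inj₁-injective (cong proj₁ p)))
    only k (inj₂ (inj₁ p)) = inj₂ (inj₁ (inj₂-injective (inj₁-injective (cong proj₁ p))))
    only k (inj₂ (inj₂ p)) = inj₂ (inj₂ (cong proj₁ p))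

  indicator-true : ∀ {x y} → true ≡ indicator x y → y ≡ x
  indicator-true {x} {y} eq with y ≟ x
  ... | yes p = p
  indicator-true () | no _

module _ {G} (critical : Critical G) where

  open Critical critical

  module Digon (F : Frame 2) (I : Iso G (framed F)) where

    open Frame F
    open Framed F (Iso.noBridge I bridgeless) (Iso.degree3 I cubic) (Iso.noLoop I)

    private
      A = framed F

    -- At a common foot the third edge would be a bridge. So there would be no further outer vertex,
    -- and that edge would have to be a loop or a third spoke.
    feet-differ : foot zero ≢ foot (suc zero)
    feet-differ eq = impossible incident
      where
      open SharedFoot (sharedFoot zero (suc zero) (λ ()) eq)

      all : ∀ y → y ≡ foot zero
      all y = indicator-true (paint-const (indicator (foot zero)) true other
        (λ { zero _ → sym (dec-true (foot zero ≟ foot zero) refl)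
           ; (suc zero) _ → sym (dec-true (foot (suc zero) ≟ foot zero) (sym eq)) }) isolated y)

      impossible : _ → ⊥
      impossible (inj₁ (zero , p , _))     = spoke-i (sym p)
      impossible (inj₁ (suc zero , p , _)) = spoke-j (sym p)
      impossible (inj₂ (l , _ , _))        = rest-loopless l (trans (all _) (sym (all _)))

    H : Graph
    H = record
      { #V = #outer
      ; #E = suc #rest
      ; src = λ { zero → foot zero ; (suc j) → restSrc j }
      ; tgt = λ { zero → foot (suc zero) ; (suc j) → restTgt j }
      ; loopless = λ { zero → feet-differ ; (suc j) → rest-loopless j }
      }

    replacement : Replacement F ⟦ H ⟧
    replacement = record
      { place = id ; place-injective = id
      ; stub = λ { zero → zero , false ; (suc zero) → zero , true }
      ; stub-tail = λ { zero → refl ; (suc zero) → refl }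
      ; stub-injective = λ { {zero} {zero} _ → refl ; {suc zero} {suc zero} _ → refl
                           ; {zero} {suc zero} () ; {suc zero} {zero} () }
      ; old = suc ; old-src = λ _ → refl ; old-tgt = λ _ → refl ; old-injective = suc-injective
      ; stub≢old = λ { zero _ () ; (suc zero) _ () }
      ; covered = λ { (zero , false) _ _ → inj₁ (zero , refl)
                    ; (zero , true) _ _ → inj₁ (suc zero , refl)
                    ; (suc j , _) _ _ → inj₂ (j , refl) }
      }

    minorMap : MinorMap A ⟦ H ⟧
    minorMap = record
      -- One rim edge and spoke 1 are contracted, the other rim edge is deleted, and spoke 0
      -- survives as the new edge.
      { branch = [ (λ _ → foot (suc zero)) , id ]
      ; root = outer
      ; branch-root = λ _ → refl
      ; path = λ { (core zero) → (refl , rim zero , inj₁ (refl , refl))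
                               ◅ (refl , spoke (suc zero) , inj₁ (refl , refl)) ◅ ε
                 ; (core (suc zero)) → (refl , spoke (suc zero) , inj₁ (refl , refl)) ◅ ε
                 ; (outer _) → ε }
      ; edge = λ { zero → spoke zero ; (suc j) → rest j }
      ; edge-injective = λ { {zero} {zero} _ → refl ; {suc _} {suc _} refl → refl
                           ; {zero} {suc _} () ; {suc _} {zero} () }
      ; ends = λ { zero → inj₂ (refl , refl) ; (suc j) → inj₁ (refl , refl) }
      }

    -- The rim takes the colour of foot 0, so that spoke 1 stands in for the new edge and is exempt
    -- exactly when that edge is.
    bridgelessH : NoBridge ⟦ H ⟧
    bridgelessH χ zero same a b = trans (sym (const a)) (const b)
      where
      const = paint-const χ (χ (foot zero)) (spoke (suc zero))
        (λ { zero _ → refl ; (suc zero) ≢f → contradiction refl ≢f }) (λ j _ → same (suc j) λ ())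
    bridgelessH χ (suc j) same a b = trans (sym (const a)) (const b)
      where
      const = paint-const χ (χ (foot zero)) (rest j)
        (λ { zero _ → refl ; (suc zero) _ → same zero λ () })
        (λ k ≢f → same (suc k) (λ p → ≢f (cong inj₂ (suc-injective p))))

    absurd : ⊥
    absurd = irreducible critical I H minorMap {rim zero} (λ { zero () ; (suc _) () })
      (2≤-distinct feet-differ)
      (λ v → Degree3-transport (Replacement.localIso replacement v) (Iso.degree3 I cubic (outer v)))
      bridgelessH
      λ (_ , 𝒟 , _ , once) → let open LabellingFromCDC H 𝒟 once in
        Replacement.extend replacement {o = face} {face ∘ rev ⟦ H ⟧} face-good (λ _ _ → refl)
          (rimFace⁻ _ _ (Replacement.arrive≢depart replacement face-good (λ _ _ → refl))
            λ { zero → refl ; (suc zero) → refl })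

-- The only derangements of three objects are the two rotations. At the apex of a contracted
-- triangle they are the two directions in which the rim can become a face.
rotate3 : ∀ {L : Set} (arrive depart : Fin 3 → L) → Injective _≡_ _≡_ arrive → (∀ i → arrive i ≢ depart i) →
          (∀ i → ∃ λ k → depart k ≡ arrive i) →
          (∀ i → arrive i ≡ depart (next i)) ⊎ (∀ i → arrive (next i) ≡ depart i)
rotate3 a d a-inj a≢d onto with onto zero | onto (suc zero) | onto (suc (suc zero))
... | zero , p | _ | _ = contradiction (sym p) (a≢d zero)
... | _ | suc zero , q | _ = contradiction (sym q) (a≢d (suc zero))
... | _ | _ | suc (suc zero) , r = contradiction (sym r) (a≢d (suc (suc zero)))
... | suc zero , p | suc (suc zero) , q | zero , r =
      inj₁ λ { zero → sym p ; (suc zero) → sym q ; (suc (suc zero)) → sym r }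
... | suc (suc zero) , p | zero , q | suc zero , r =
      inj₂ λ { zero → sym q ; (suc zero) → sym r ; (suc (suc zero)) → sym p }
... | suc zero , p | _ | suc zero , r = contradiction (a-inj (trans (sym p) r)) λ ()
... | suc (suc zero) , p | suc (suc zero) , q | _ = contradiction (a-inj (trans (sym p) q)) λ ()
... | _ | zero , q | zero , r = contradiction (a-inj (trans (sym q) r)) λ ()

module _ {G} (critical : Critical G) where

  open Critical critical

  module Triangle (F : Frame 3) (I : Iso G (framed F)) where

    open Frame F
    open Framed F (Iso.noBridge I bridgeless) (Iso.degree3 I cubic) (Iso.noLoop I)

    private
      A = framed F

    H : Graph
    H = record
      { #V = suc #outer
      ; #E = suc (suc (suc #rest))
      ; src = λ { (suc (suc (suc j))) → suc (restSrc j) ; _ → zero }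
      ; tgt = λ { zero → suc (foot zero) ; (suc zero) → suc (foot (suc zero))
                ; (suc (suc zero)) → suc (foot (suc (suc zero))) ; (suc (suc (suc j))) → suc (restTgt j) }
      ; loopless = λ { zero () ; (suc zero) () ; (suc (suc zero)) ()
                     ; (suc (suc (suc j))) eq → rest-loopless j (suc-injective eq) }
      }

    edgeOf : Fin 3 → Graph.Edge H
    edgeOf i = i ↑ˡ #rest

    replacement : Replacement F ⟦ H ⟧
    replacement = record
      { place = suc ; place-injective = suc-injective
      ; stub = λ i → edgeOf i , true
      ; stub-tail = λ { zero → refl ; (suc zero) → refl ; (suc (suc zero)) → refl }
      ; stub-injective = λ {i} {j} eq → ↑ˡ-injective #rest i j (cong proj₁ eq)
      ; old = 3 ↑ʳ_ ; old-src = λ _ → refl ; old-tgt = λ _ → refl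
      ; old-injective = λ eq → suc-injective (suc-injective (suc-injective eq))
      ; stub≢old = λ { zero _ () ; (suc zero) _ () ; (suc (suc zero)) _ () }
      ; covered = λ { (zero , true) _ _ → inj₁ (zero , refl)
                    ; (suc zero , true) _ _ → inj₁ (suc zero , refl)
                    ; (suc (suc zero) , true) _ _ → inj₁ (suc (suc zero) , refl)
                    ; (zero , false) _ ()
                    ; (suc zero , false) _ ()
                    ; (suc (suc zero) , false) _ ()
                    ; (suc (suc (suc j)) , _) _ _ → inj₂ (j , refl) }
      }

    minorMap : MinorMap A ⟦ H ⟧
    minorMap = record
      { branch = [ (λ _ → zero) , suc ]
      ; root = λ { zero → core zero ; (suc x) → outer x }
      ; branch-root = λ { zero → refl ; (suc _) → refl }
      ; path = λ { (core zero) → ε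
                 ; (core (suc zero)) → (refl , rim zero , inj₂ (refl , refl)) ◅ ε
                 ; (core (suc (suc zero))) → (refl , rim (suc (suc zero)) , inj₁ (refl , refl)) ◅ ε
                 ; (outer _) → ε }
      ; edge = edge
      ; edge-injective = λ {e} {e′} eq → trans (sym (back-edge e)) (trans (cong back eq) (back-edge e′))
      ; ends = λ { zero → inj₁ (refl , refl) ; (suc zero) → inj₁ (refl , refl)
                 ; (suc (suc zero)) → inj₁ (refl , refl) ; (suc (suc (suc j))) → inj₁ (refl , refl) }
      }
      where
      edge : Graph.Edge H → E A
      edge zero                = spoke zero
      edge (suc zero)          = spoke (suc zero)
      edge (suc (suc zero))    = spoke (suc (suc zero))
      edge (suc (suc (suc j))) = rest j

      back : E A → Graph.Edge H
      back (rim i)   = edgeOf i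
      back (spoke i) = edgeOf i
      back (rest j)  = 3 ↑ʳ j

      back-edge : ∀ e → back (edge e) ≡ e
      back-edge zero                = refl
      back-edge (suc zero)          = refl
      back-edge (suc (suc zero))    = refl
      back-edge (suc (suc (suc j))) = refl

    bridgelessH : NoBridge ⟦ H ⟧
    bridgelessH χ f same a b = trans (sym (const a)) (const b)
      where
      edge : Graph.Edge H → E A
      edge = MinorMap.edge minorMap

      const′ : ∀ x → χ zero ≡ χ (suc x)
      const′ = paint-const (χ ∘ suc) (χ zero) (edge f)
        (λ { zero ≢f → same zero (≢f ∘ cong edge)
           ; (suc zero) ≢f → same (suc zero) (≢f ∘ cong edge)
           ; (suc (suc zero)) ≢f → same (suc (suc zero)) (≢f ∘ cong edge) })
        (λ j ≢f → same (suc (suc (suc j))) (≢f ∘ cong edge))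

      const : ∀ v → χ zero ≡ χ v
      const zero    = refl
      const (suc x) = const′ x

    degree3H : ∀ v → Degree3 ⟦ H ⟧ v
    degree3H zero = record
      { dart = λ i → edgeOf i , false
      ; dart-tail = λ { zero → refl ; (suc zero) → refl ; (suc (suc zero)) → refl }
      ; injective = λ {i} {j} eq → ↑ˡ-injective #rest i j (cong proj₁ eq)
      ; complete = λ { (zero , false) _ → zero , refl
                     ; (suc zero , false) _ → suc zero , refl
                     ; (suc (suc zero) , false) _ → suc (suc zero) , refl
                     ; (zero , true) () ; (suc zero , true) () ; (suc (suc zero) , true) ()
                     ; (suc (suc (suc _)) , false) () ; (suc (suc (suc _)) , true) () }
      }
    degree3H (suc x) = Degree3-transport (Replacement.localIso replacement x) (Iso.degree3 I cubic (outer x))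

    labels : HasOrientableCDC H → FaceLabelling A
    labels (_ , 𝒟 , _ , once) = Replacement.extend replacement {o = face} {face ∘ rev ⟦ H ⟧} good (λ _ _ → refl)
      ([ rimFace⁻ _ _ differ , rimFace⁺ _ _ differ ]′ (rotate3 arrive depart arrive-injective differ onto))
      where
      open LabellingFromCDC H 𝒟 once
      module Apex = GoodAt (face-good zero)

      good : ∀ x → GoodAt ⟦ H ⟧ face (face ∘ rev ⟦ H ⟧) (suc x)
      good x = face-good (suc x)

      arrive depart : Fin 3 → Fin _
      arrive i = face (edgeOf i , true)
      depart i = face (edgeOf i , false)

      differ : ∀ i → arrive i ≢ depart i
      differ = Replacement.arrive≢depart replacement good (λ _ _ → refl)

      at-apex : ∀ i → tail ⟦ H ⟧ (edgeOf i , false) ≡ zero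
      at-apex = Degree3.dart-tail (degree3H zero)

      arrive-injective : Injective _≡_ _≡_ arrive
      arrive-injective {i} {j} eq = ↑ˡ-injective #rest i j
        (cong proj₁ (Apex.in-injective (edgeOf i , false) (edgeOf j , false) (at-apex i) (at-apex j) eq))

      onto : ∀ i → ∃ λ k → depart k ≡ arrive i
      onto i with Apex.successor (edgeOf i , false) (at-apex i)
      ... | d , t , eq with Degree3.complete (degree3H zero) d t
      ... | k , refl = k , eq

    absurd : ⊥
    absurd = irreducible critical I H minorMap {rim zero}
      (λ { zero () ; (suc zero) () ; (suc (suc zero)) () ; (suc (suc (suc _))) () })
      (s≤s (nonempty (foot zero))) degree3H bridgelessH labels
      where
      nonempty : ∀ {n} → Fin n → 1 ≤ n
      nonempty {suc _} _ = s≤s z≤n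

-- In the next three lemmas arrive i ≡ depart j says that the face entering along spoke i
-- leaves along spoke j.
module _ {L : Set} (arrive depart : Fin 4 → L) where

  -- Each face follows two consecutive rim edges to the opposite spoke, those from 0 and 2 forward
  -- and those from 1 and 3 backward, so every rim edge is run once each way.
  crossing : arrive 0F ≡ depart 2F → arrive 1F ≡ depart 3F → arrive 2F ≡ depart 0F → arrive 3F ≡ depart 1F →
    arrive 0F ≢ arrive 1F → arrive 0F ≢ arrive 2F → arrive 0F ≢ arrive 3F →
    arrive 1F ≢ arrive 2F → arrive 1F ≢ arrive 3F → arrive 2F ≢ arrive 3F → RimLabels arrive depart
  crossing e₀ e₁ e₂ e₃ d₀₁ d₀₂ d₀₃ d₁₂ d₁₃ d₂₃ = record
    { forward  = λ { 0F → arrive 0F ; 1F → arrive 0F ; 2F → arrive 2F ; 3F → arrive 2F }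
    ; backward = λ { 0F → arrive 1F ; 1F → arrive 3F ; 2F → arrive 3F ; 3F → arrive 1F }
    ; distinct = λ
        { 0F → d₀₁ , (λ p → d₁₂ (trans p (sym e₂))) , (λ p → d₀₂ (sym (trans e₂ p)))
        ; 1F → d₀₁ , (λ p → d₁₃ (trans p (sym e₃))) , (λ p → d₀₃ (sym (trans e₃ p)))
        ; 2F → d₂₃ , (λ p → d₀₃ (sym (trans p (sym e₀)))) , (λ p → d₀₂ (trans e₀ p))
        ; 3F → d₂₃ , (λ p → d₁₃ (sym (trans p (sym e₁)))) , (λ p → d₁₂ (trans e₁ p)) }
    ; rotation = λ
        { 0F → inj₁ (refl , e₂ , refl)
        ; 1F → inj₂ (e₃ , refl , refl)
        ; 2F → inj₁ (refl , e₀ , refl)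
        ; 3F → inj₂ (e₁ , refl , refl) }
    }

  module _ (e₀ : arrive 0F ≡ depart 3F) (e₁ : arrive 1F ≡ depart 2F)
           (e₂ : arrive 2F ≡ depart 1F) (e₃ : arrive 3F ≡ depart 0F)
           (d₀₃ : arrive 0F ≢ arrive 3F) (d₁₂ : arrive 1F ≢ arrive 2F)
           (d₀₂ : arrive 0F ≢ arrive 2F) (d₁₃ : arrive 1F ≢ arrive 3F) where

    -- The faces entering at 0 and at 1 go the long way round, forward and backward, while the other
    -- two use a single rim edge each. The long ones meet on rim edges 0 and 2, which is where they
    -- have to differ.
    detour₀₁ : arrive 0F ≢ arrive 1F → RimLabels arrive depart
    detour₀₁ d₀₁ = record
      { forward  = λ { 0F → arrive 0F ; 1F → arrive 0F ; 2F → arrive 0F ; 3F → arrive 3F }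
      ; backward = λ { 0F → arrive 1F ; 1F → arrive 2F ; 2F → arrive 1F ; 3F → arrive 1F }
      ; distinct = λ
          { 0F → d₀₁ , (λ p → d₁₃ (trans p (sym e₃))) , (λ p → d₀₃ (sym (trans e₃ p)))
          ; 1F → d₀₁ , (λ p → d₁₂ (trans p (sym e₂))) , (λ p → d₀₂ (sym (trans e₂ p)))
          ; 2F → d₀₂ , (λ p → d₁₂ (sym (trans p (sym e₁)))) , (λ p → d₀₁ (sym (trans e₁ p)))
          ; 3F → (λ p → d₁₃ (sym p)) , (λ p → d₀₁ (sym (trans p (sym e₀)))) , (λ p → d₀₃ (trans e₀ p)) }
      ; rotation = λ
          { 0F → inj₁ (refl , e₃ , refl)
          ; 1F → inj₂ (e₂ , refl , refl)
          ; 2F → inj₂ (e₁ , refl , refl)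
          ; 3F → inj₁ (refl , e₀ , refl) }
      }

    -- The same with the long ways given to the faces entering at 2, forward, and at 3, backward.
    detour₂₃ : arrive 2F ≢ arrive 3F → RimLabels arrive depart
    detour₂₃ d₂₃ = record
      { forward  = λ { 0F → arrive 2F ; 1F → arrive 1F ; 2F → arrive 2F ; 3F → arrive 2F }
      ; backward = λ { 0F → arrive 3F ; 1F → arrive 3F ; 2F → arrive 3F ; 3F → arrive 0F }
      ; distinct = λ
          { 0F → (λ p → d₀₂ (sym p)) , (λ p → d₀₃ (trans p (sym e₃))) , (λ p → d₂₃ (sym (trans e₃ p)))
          ; 1F → d₁₃ , (λ p → d₂₃ (sym (trans p (sym e₂)))) , (λ p → d₁₂ (sym (trans e₂ p)))
          ; 2F → d₂₃ , (λ p → d₁₃ (sym (trans p (sym e₁)))) , (λ p → d₁₂ (trans e₁ p))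
          ; 3F → d₂₃ , (λ p → d₀₃ (sym (trans p (sym e₀)))) , (λ p → d₀₂ (trans e₀ p)) }
      ; rotation = λ
          { 0F → inj₂ (e₃ , refl , refl)
          ; 1F → inj₁ (refl , e₂ , refl)
          ; 2F → inj₁ (refl , e₁ , refl)
          ; 3F → inj₂ (e₀ , refl , refl) }
      }

-- The obstruction to pairing feet 0, 3 and feet 1, 2: a partition of the outer graph separating the
-- two pairs that at most one of its edges crosses.
record Partition (F : Frame 4) : Set where
  open Frame F
  field
    side      : Fin #outer → Bool
    bridge    : Maybe (Fin #rest)
    same₀₃    : side (foot 0F) ≡ side (foot 3F)
    same₁₂    : side (foot 1F) ≡ side (foot 2F)
    separated : side (foot 0F) ≢ side (foot 1F)
    uncrossed : ∀ j → bridge ≢ just j → side (restSrc j) ≡ side (restTgt j)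

-- Shifting the rim by one changes the pairing 03, 12 of the feet into 10, 23, so one reduction
-- serves both pairings.
rotate : Frame 4 → Frame 4
rotate F = record { foot = foot ∘ next ; restSrc = restSrc ; restTgt = restTgt }
  where open Frame F

rotate-iso : ∀ {G F} → Iso G (framed F) → Iso G (framed (rotate F))
rotate-iso {G} {F} I = record
  { vto = I.vto ∘ vturn ; vfrom = vback ∘ I.vfrom
  ; vto-vfrom = λ v → trans (cong I.vto (vturn-vback (I.vfrom v))) (I.vto-vfrom v)
  ; vfrom-vto = λ a → trans (cong vback (I.vfrom-vto (vturn a))) (vback-vturn a)
  ; eto = I.eto ∘ eturn ; efrom = eback ∘ I.efrom
  ; eto-efrom = λ e → trans (cong I.eto (eturn-eback (I.efrom e))) (I.eto-efrom e)
  ; efrom-eto = λ a → trans (cong eback (I.efrom-eto (eturn a))) (eback-eturn a)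
  ; joins = λ { (rim i) → I.joins (rim (next i)) ; (spoke i) → I.joins (spoke (next i)) ; (rest j) → I.joins (rest j) }
  }
  where
  open Frame F
  module I = Iso I

  vturn vback : Fin 4 ⊎ Fin #outer → Fin 4 ⊎ Fin #outer
  vturn (core i)  = core (next i)
  vturn (outer x) = outer x
  vback (core i)  = core (prev i)
  vback (outer x) = outer x

  vturn-vback : ∀ v → vturn (vback v) ≡ v
  vturn-vback (core i)  = cong inj₁ (next-prev i)
  vturn-vback (outer _) = refl

  vback-vturn : ∀ v → vback (vturn v) ≡ v
  vback-vturn (core i)  = cong inj₁ (prev-next i)
  vback-vturn (outer _) = refl

  eturn eback : (Fin 4 ⊎ Fin 4) ⊎ Fin #rest → (Fin 4 ⊎ Fin 4) ⊎ Fin #rest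
  eturn (rim i)   = rim (next i)
  eturn (spoke i) = spoke (next i)
  eturn (rest j)  = rest j
  eback (rim i)   = rim (prev i)
  eback (spoke i) = spoke (prev i)
  eback (rest j)  = rest j

  eturn-eback : ∀ e → eturn (eback e) ≡ e
  eturn-eback (rim i)   = cong (λ i → rim i) (next-prev i)
  eturn-eback (spoke i) = cong (λ i → spoke i) (next-prev i)
  eturn-eback (rest _)  = refl

  eback-eturn : ∀ e → eback (eturn e) ≡ e
  eback-eturn (rim i)   = cong (λ i → rim i) (prev-next i)
  eback-eturn (spoke i) = cong (λ i → spoke i) (prev-next i)
  eback-eturn (rest _)  = refl

two-valued : ∀ {a b c : Bool} → a ≢ b → a ≢ c → b ≡ c
two-valued a≢b a≢c = trans (¬-not (a≢b ∘ sym)) (sym (¬-not (a≢c ∘ sym)))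

module PartitionClash (F : Frame 4) (bridgeless : NoBridge (framed F)) (cubic : ∀ v → Degree3 (framed F) v)
                      (noLoop : ∀ e → src (framed F) e ≢ tgt (framed F) e)
                      (P : Partition F) (Q : Partition (rotate F)) where

  open Frame F
  open Framed F bridgeless cubic noLoop
  private
    module P = Partition P
    module Q = Partition Q

  quarter : Bool → Bool → Fin #outer → Bool
  quarter x y v = does (P.side v 𝔹.≟ x) ∧ does (Q.side v 𝔹.≟ y)

  quarter-true : ∀ {x y v} → P.side v ≡ x → Q.side v ≡ y → quarter x y v ≡ true
  quarter-true p q = cong₂ _∧_ (dec-true (_ 𝔹.≟ _) p) (dec-true (_ 𝔹.≟ _) q)

  quarter-false₁ : ∀ {x y v} → P.side v ≢ x → quarter x y v ≡ false
  quarter-false₁ {x} {y} {v} ¬p = cong (_∧ does (Q.side v 𝔹.≟ y)) (dec-false (P.side v 𝔹.≟ x) ¬p)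

  quarter-false₂ : ∀ {x y v} → Q.side v ≢ y → quarter x y v ≡ false
  quarter-false₂ {x} {y} {v} ¬q = trans (cong (does (P.side v 𝔹.≟ x) ∧_) (dec-false (Q.side v 𝔹.≟ y) ¬q)) (𝔹.∧-zeroʳ _)

  Isolated : Bool → Bool → Set
  Isolated x y = ∀ l → quarter x y (restSrc l) ≡ quarter x y (restTgt l)

  same-sides : ∀ {x y u v} → P.side u ≡ P.side v → Q.side u ≡ Q.side v → quarter x y u ≡ quarter x y v
  same-sides {x} {y} p q = cong₂ (λ a b → does (a 𝔹.≟ x) ∧ does (b 𝔹.≟ y)) p q

  -- Distinct bridges have both ends on the same side of the other partition, so their four ends
  -- leave out one of the quarters; a common bridge has only two ends.
  isolated-quarter : ∃₂ Isolated
  isolated-quarter with P.bridge in p | Q.bridge in q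
  ... | f | g with Maybe.≡-dec _≟_ f g
  isolated-quarter | just j | just j | yes refl = shared
    where
    elsewhere : ∀ {x y} l → l ≢ j → quarter x y (restSrc l) ≡ quarter x y (restTgt l)
    elsewhere l ≢j = same-sides (P.uncrossed l (λ r → ≢j (just-injective (trans (sym r) p))))
                                (Q.uncrossed l (λ r → ≢j (just-injective (trans (sym r) q))))

    shared : ∃₂ Isolated
    shared with Q.side (restSrc j) 𝔹.≟ Q.side (restTgt j)
    -- Both ends of the common bridge lie on one side of `Q`, so either quarter on the other side
    -- will do.
    ... | yes eq = true , not (Q.side (restSrc j)) , λ l → at l (l ≟ j)
      where
      at : ∀ l → Dec (l ≡ j) → _
      at l (no ≢j)    = elsewhere l ≢j
      at l (yes refl) = trans (quarter-false₂ (not-¬ refl)) (sym (quarter-false₂ (not-¬ (sym eq))))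
    -- The source misses this quarter by its side in `P`, the target by its side in `Q`.
    ... | no ≢ = not (P.side (restSrc j)) , Q.side (restSrc j) , λ l → at l (l ≟ j)
      where
      at : ∀ l → Dec (l ≡ j) → _
      at l (no ≢j)    = elsewhere l ≢j
      at l (yes refl) = trans (quarter-false₁ (not-¬ refl)) (sym (quarter-false₂ (≢ ∘ sym)))
  isolated-quarter | nothing | nothing | yes refl =
    true , true , λ l → same-sides (P.uncrossed l (λ r → contradiction (trans (sym p) r) λ ()))
                                   (Q.uncrossed l (λ r → contradiction (trans (sym q) r) λ ()))
  isolated-quarter | f | g | no f≢g =
    -- The quarter avoids the `P`-side of the bridge of `Q` and the `Q`-side of the bridge of `P`. A
    -- missing bridge leaves its coordinate free, and `true` is arbitrary.
    maybe (λ l → not (P.side (restSrc l))) true g , maybe (λ l → not (Q.side (restSrc l))) true f ,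
    λ l → at l (Maybe.≡-dec _≟_ f (just l)) (Maybe.≡-dec _≟_ g (just l))
    where
    at : ∀ l → Dec (f ≡ just l) → Dec (g ≡ just l) → _
    at l (yes refl) (yes refl) = contradiction refl f≢g
    at l (yes refl) (no ≢g) = trans (quarter-false₂ (not-¬ refl)) (sym (quarter-false₂ (not-¬
      (sym (Q.uncrossed l (λ r → ≢g (trans (sym q) r)))))))
    at l (no ≢f) (yes refl) = trans (quarter-false₁ (not-¬ refl)) (sym (quarter-false₁ (not-¬
      (sym (P.uncrossed l (λ r → ≢f (trans (sym p) r)))))))
    at l (no ≢f) (no ≢g) = same-sides (P.uncrossed l (λ r → ≢f (trans (sym p) r)))
                                      (Q.uncrossed l (λ r → ≢g (trans (sym q) r)))

  -- On the feet `P` is the split 03|12 and `Q` the split 01|23, so their sides intersect in single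
  -- feet.
  corner : ∀ x y → ∃ λ i → quarter x y (foot i) ≡ true × (∀ k → k ≢ i → quarter x y (foot k) ≡ false)
  corner x y with P.side (foot 0F) 𝔹.≟ x | Q.side (foot 0F) 𝔹.≟ y
  ... | yes refl | yes refl = 0F , quarter-true refl refl , λ
        { 0F ≢ → contradiction refl ≢
        ; 1F _ → quarter-false₁ (P.separated ∘ sym)
        ; 2F _ → quarter-false₁ (λ r → P.separated (sym (trans P.same₁₂ r)))
        ; 3F _ → quarter-false₂ (λ r → Q.separated (trans Q.same₀₃ (trans (sym r) (sym Q.same₁₂)))) }
  ... | no ≢x | yes refl = 1F , quarter-true (two-valued P.separated ≢x) Q.same₀₃ , λ
        { 0F _ → quarter-false₁ ≢x
        ; 1F ≢ → contradiction refl ≢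
        ; 2F _ → quarter-false₂ (λ r → Q.separated (trans Q.same₀₃ (sym r)))
        ; 3F _ → quarter-false₁ (λ r → ≢x (trans P.same₀₃ r)) }
  ... | no ≢x | no ≢y = 2F , quarter-true (trans (sym P.same₁₂) (two-valued P.separated ≢x)) opposite , λ
        { 0F _ → quarter-false₁ ≢x
        ; 1F _ → quarter-false₂ (λ r → ≢y (trans (sym Q.same₀₃) r))
        ; 2F ≢ → contradiction refl ≢
        ; 3F _ → quarter-false₁ (λ r → ≢x (trans P.same₀₃ r)) }
    where
    opposite : Q.side (foot 2F) ≡ y
    opposite = two-valued (λ r → Q.separated (trans Q.same₀₃ r)) ≢y
  ... | yes refl | no ≢y = 3F , quarter-true (sym P.same₀₃) opposite , λ
        { 0F _ → quarter-false₂ ≢y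
        ; 1F _ → quarter-false₂ (λ r → ≢y (trans (sym Q.same₀₃) r))
        ; 2F _ → quarter-false₁ (λ r → P.separated (sym (trans P.same₁₂ r)))
        ; 3F ≢ → contradiction refl ≢ }
    where
    opposite : Q.side (foot 3F) ≡ y
    opposite = trans (sym Q.same₁₂) (two-valued (λ r → Q.separated (trans Q.same₀₃ r)) ≢y)

  -- The only edge that can leave the isolated quarter is the spoke at its single foot, and this
  -- spoke is a bridge.
  absurd : ⊥
  absurd with x , y , isolated ← isolated-quarter with i , hit , miss ← corner x y =
    contradiction (trans (paint-const (quarter x y) false (spoke i)
      (λ k ≢i → sym (miss k (λ k≡i → ≢i (cong (λ k → spoke k) k≡i)))) (λ l _ → isolated l) (foot i)) hit) λ ()

module _ {G} (critical : Critical G) where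

  open Critical critical

  module Square (F : Frame 4) (I : Iso G (framed F)) (¬partition : ¬ Partition F) where

    open Frame F
    open Framed F (Iso.noBridge I bridgeless) (Iso.degree3 I cubic) (Iso.noLoop I)

    private
      A = framed F

    -- At most one edge other than a spoke leaves a shared foot. If foot `a` were there too, spoke
    -- `b` would be a bridge unless foot `b` coincided as well, and then four spokes would meet at a
    -- vertex of degree three.
    shared-foot-cut : ∀ i j a b → i ≢ j → a ≢ i → a ≢ j → b ≢ i → b ≢ j → a ≢ b →
      (∀ k → k ≢ b → k ≡ i ⊎ k ≡ j ⊎ k ≡ a) → foot i ≡ foot j →
      foot a ≢ foot i × ∃ λ (f : Maybe (Fin #rest)) →
        ∀ l → f ≢ just l → indicator (foot i) (restSrc l) ≡ indicator (foot i) (restTgt l)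
    shared-foot-cut i j a b i≢j a≢i a≢j b≢i b≢j a≢b all eq = a-off , bridge incident
      where
      open SharedFoot (sharedFoot i j i≢j eq)

      a-off : foot a ≢ foot i
      a-off p with only a p
      ... | inj₁ q        = a≢i q
      ... | inj₂ (inj₁ q) = a≢j q
      ... | inj₂ (inj₂ q) = ⊥-elim (b-off (only b b-on))
        where
        on : ∀ k → k ≡ i ⊎ k ≡ j ⊎ k ≡ a → true ≡ indicator (foot i) (foot k)
        on k (inj₁ refl)        = sym (dec-true (foot k ≟ foot i) refl)
        on k (inj₂ (inj₁ refl)) = sym (dec-true (foot k ≟ foot i) (sym eq))
        on k (inj₂ (inj₂ refl)) = sym (dec-true (foot k ≟ foot i) p)

        b-on : foot b ≡ foot i
        b-on = indicator-true (paint-const (indicator (foot i)) true (spoke b)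
          (λ k ≢b → on k (all k (λ { refl → ≢b refl })))
          (λ l _ → isolated l λ r → contradiction (trans q (sym r)) λ ()) (foot b))

        b-off : b ≡ i ⊎ b ≡ j ⊎ spoke b ≡ other → ⊥
        b-off (inj₁ r)        = b≢i r
        b-off (inj₂ (inj₁ r)) = b≢j r
        b-off (inj₂ (inj₂ r)) = a≢b (inj₂-injective (inj₁-injective (trans q (sym r))))

      bridge : _ → _
      bridge (inj₁ (k , p , _)) = nothing , λ l _ → isolated l λ r → contradiction (trans r p) λ ()
      bridge (inj₂ (l , p , _)) = just l , λ k ≢k → isolated k λ r → ≢k (cong just (sym (inj₂-injective (trans r p))))

    -- This keeps the new edge from being a loop: a common foot of spokes 0 and 3, taken alone, is
    -- one side of a partition.
    feet₀₃-differ : foot 0F ≢ foot 3F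
    feet₀₃-differ eq with shared-foot-cut 0F 3F 1F 2F (λ ()) (λ ()) (λ ()) (λ ()) (λ ()) (λ ())
                            (λ { 0F _ → inj₁ refl ; 1F _ → inj₂ (inj₂ refl) ; 2F ≢ → contradiction refl ≢ ; 3F _ → inj₂ (inj₁ refl) }) eq
                        | shared-foot-cut 0F 3F 2F 1F (λ ()) (λ ()) (λ ()) (λ ()) (λ ()) (λ ())
                            (λ { 0F _ → inj₁ refl ; 1F ≢ → contradiction refl ≢ ; 2F _ → inj₂ (inj₂ refl) ; 3F _ → inj₂ (inj₁ refl) }) eq
    ... | off₁ , f , uncrossed | off₂ , _ = ¬partition record
      { side = indicator (foot 0F) ; bridge = f
      ; same₀₃ = cong (indicator (foot 0F)) eq
      ; same₁₂ = trans (dec-false (foot 1F ≟ foot 0F) off₁) (sym (dec-false (foot 2F ≟ foot 0F) off₂))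
      ; separated = λ p → off₁ (indicator-true (trans (sym (dec-true (foot 0F ≟ foot 0F) refl)) p))
      ; uncrossed = uncrossed }

    feet₁₂-differ : foot 1F ≢ foot 2F
    feet₁₂-differ eq with shared-foot-cut 1F 2F 0F 3F (λ ()) (λ ()) (λ ()) (λ ()) (λ ()) (λ ())
                            (λ { 0F _ → inj₂ (inj₂ refl) ; 1F _ → inj₁ refl ; 2F _ → inj₂ (inj₁ refl) ; 3F ≢ → contradiction refl ≢ }) eq
                        | shared-foot-cut 1F 2F 3F 0F (λ ()) (λ ()) (λ ()) (λ ()) (λ ()) (λ ())
                            (λ { 0F ≢ → contradiction refl ≢ ; 1F _ → inj₁ refl ; 2F _ → inj₂ (inj₁ refl) ; 3F _ → inj₂ (inj₂ refl) }) eq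
    ... | off₀ , f , uncrossed | off₃ , _ = ¬partition record
      { side = indicator (foot 1F) ; bridge = f
      ; same₀₃ = trans (dec-false (foot 0F ≟ foot 1F) off₀) (sym (dec-false (foot 3F ≟ foot 1F) off₃))
      ; same₁₂ = cong (indicator (foot 1F)) eq
      ; separated = λ p → off₀ (indicator-true (trans (sym (dec-true (foot 1F ≟ foot 1F) refl)) (sym p)))
      ; uncrossed = uncrossed }

    H : Graph
    H = record
      { #V = #outer
      ; #E = suc (suc #rest)
      ; src = λ { 0F → foot 0F ; 1F → foot 1F ; (suc (suc j)) → restSrc j }
      ; tgt = λ { 0F → foot 3F ; 1F → foot 2F ; (suc (suc j)) → restTgt j }
      ; loopless = λ { 0F → feet₀₃-differ ; 1F → feet₁₂-differ ; (suc (suc j)) → rest-loopless j }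
      }

    pattern e₀₃ = zero , false
    pattern e₃₀ = zero , true
    pattern e₁₂ = suc zero , false
    pattern e₂₁ = suc zero , true

    replacement : Replacement F ⟦ H ⟧
    replacement = record
      { place = id ; place-injective = id
      ; stub = stub
      ; stub-tail = λ { 0F → refl ; 1F → refl ; 2F → refl ; 3F → refl }
      ; stub-injective = λ {i} {j} eq → trans (sym (back-stub i)) (trans (cong back eq) (back-stub j))
      ; old = 2 ↑ʳ_ ; old-src = λ _ → refl ; old-tgt = λ _ → refl
      ; old-injective = λ eq → suc-injective (suc-injective eq)
      ; stub≢old = λ { 0F _ () ; 1F _ () ; 2F _ () ; 3F _ () }
      ; covered = λ { e₀₃ _ _ → inj₁ (0F , refl) ; e₃₀ _ _ → inj₁ (3F , refl)
                    ; e₁₂ _ _ → inj₁ (1F , refl) ; e₂₁ _ _ → inj₁ (2F , refl)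
                    ; (suc (suc j) , _) _ _ → inj₂ (j , refl) }
      }
      where
      stub : Fin 4 → Dart ⟦ H ⟧
      stub 0F = e₀₃
      stub 1F = e₁₂
      stub 2F = e₂₁
      stub 3F = e₃₀

      back : Dart ⟦ H ⟧ → Fin 4
      back e₀₃ = 0F
      back e₃₀ = 3F
      back (_ , false) = 1F
      back (_ , true) = 2F

      back-stub : ∀ i → back (stub i) ≡ i
      back-stub 0F = refl
      back-stub 1F = refl
      back-stub 2F = refl
      back-stub 3F = refl

    minorMap : MinorMap A ⟦ H ⟧
    minorMap = record
      { branch = branch
      ; root = outer
      ; branch-root = λ _ → refl
      ; path = λ { (core 0F) → (refl , rim 3F , inj₂ (refl , refl)) ◅ (refl , spoke 3F , inj₁ (refl , refl)) ◅ ε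
                 ; (core 1F) → (refl , rim 1F , inj₁ (refl , refl)) ◅ (refl , spoke 2F , inj₁ (refl , refl)) ◅ ε
                 ; (core 2F) → (refl , spoke 2F , inj₁ (refl , refl)) ◅ ε
                 ; (core 3F) → (refl , spoke 3F , inj₁ (refl , refl)) ◅ ε
                 ; (outer _) → ε }
      ; edge = λ { 0F → spoke 0F ; 1F → spoke 1F ; (suc (suc j)) → rest j }
      ; edge-injective = λ { {0F} {0F} _ → refl ; {1F} {1F} _ → refl ; {suc (suc _)} {suc (suc _)} refl → refl
                           ; {0F} {1F} () ; {1F} {0F} () ; {0F} {suc (suc _)} () ; {1F} {suc (suc _)} ()
                           ; {suc (suc _)} {0F} () ; {suc (suc _)} {1F} () }
      ; ends = λ { 0F → inj₂ (refl , refl) ; 1F → inj₂ (refl , refl) ; (suc (suc j)) → inj₁ (refl , refl) }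
      }
      where
      -- Contracted are rim edge 3 with spoke 3 and rim edge 1 with spoke 2. Spokes 0 and 1 survive
      -- as the new edges, and rim edges 0 and 2 are deleted.
      branch : V A → V ⟦ H ⟧
      branch (core 0F) = foot 3F
      branch (core 1F) = foot 2F
      branch (core 2F) = foot 2F
      branch (core 3F) = foot 3F
      branch (outer x) = x

    -- If a new edge is exempt and one of its ends is coloured like the other pair of feet, the rim
    -- takes that colour and the spoke at the other end is exempt. If an old edge is exempt and all
    -- feet agree, so does the rim. In every remaining case the colouring is itself a partition.
    bridgelessH : NoBridge ⟦ H ⟧
    bridgelessH χ 0F same a b = constant (χ (foot 1F) 𝔹.≟ χ (foot 0F)) (χ (foot 1F) 𝔹.≟ χ (foot 3F))
      where
      same₁₂ = same 1F λ ()
      rests : ∀ j → χ (restSrc j) ≡ χ (restTgt j)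
      rests j = same (suc (suc j)) λ ()

      constant : Dec (χ (foot 1F) ≡ χ (foot 0F)) → Dec (χ (foot 1F) ≡ χ (foot 3F)) → χ a ≡ χ b
      constant (yes p) _ = trans (sym (const a)) (const b)
        where const = paint-const χ (χ (foot 1F)) (spoke 3F)
                (λ { 0F _ → p ; 1F _ → refl ; 2F _ → same₁₂ ; 3F ≢ → contradiction refl ≢ }) (λ j _ → rests j)
      constant (no _) (yes p) = trans (sym (const a)) (const b)
        where const = paint-const χ (χ (foot 1F)) (spoke 0F)
                (λ { 0F ≢ → contradiction refl ≢ ; 1F _ → refl ; 2F _ → same₁₂ ; 3F _ → p }) (λ j _ → rests j)
      constant (no p) (no q) = ⊥-elim (¬partition record
        { side = χ ; bridge = nothing ; same₀₃ = two-valued p q ; same₁₂ = same₁₂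
        ; separated = p ∘ sym ; uncrossed = λ j _ → rests j })
    bridgelessH χ 1F same a b = constant (χ (foot 0F) 𝔹.≟ χ (foot 1F)) (χ (foot 0F) 𝔹.≟ χ (foot 2F))
      where
      same₀₃ = same 0F λ ()
      rests : ∀ j → χ (restSrc j) ≡ χ (restTgt j)
      rests j = same (suc (suc j)) λ ()

      constant : Dec (χ (foot 0F) ≡ χ (foot 1F)) → Dec (χ (foot 0F) ≡ χ (foot 2F)) → χ a ≡ χ b
      constant (yes p) _ = trans (sym (const a)) (const b)
        where const = paint-const χ (χ (foot 0F)) (spoke 2F)
                (λ { 0F _ → refl ; 1F _ → p ; 2F ≢ → contradiction refl ≢ ; 3F _ → same₀₃ }) (λ j _ → rests j)
      constant (no _) (yes p) = trans (sym (const a)) (const b)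
        where const = paint-const χ (χ (foot 0F)) (spoke 1F)
                (λ { 0F _ → refl ; 1F ≢ → contradiction refl ≢ ; 2F _ → p ; 3F _ → same₀₃ }) (λ j _ → rests j)
      constant (no p) (no q) = ⊥-elim (¬partition record
        { side = χ ; bridge = nothing ; same₀₃ = same₀₃ ; same₁₂ = two-valued p q
        ; separated = p ; uncrossed = λ j _ → rests j })
    bridgelessH χ (suc (suc l)) same a b = constant (χ (foot 0F) 𝔹.≟ χ (foot 1F))
      where
      same₀₃ = same 0F λ ()
      same₁₂ = same 1F λ ()
      rests : ∀ j → j ≢ l → χ (restSrc j) ≡ χ (restTgt j)
      rests j ≢l = same (suc (suc j)) (≢l ∘ suc-injective ∘ suc-injective)

      constant : Dec (χ (foot 0F) ≡ χ (foot 1F)) → χ a ≡ χ b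
      constant (yes p) = trans (sym (const a)) (const b)
        where const = paint-const χ (χ (foot 0F)) (rest l)
                (λ { 0F _ → refl ; 1F _ → p ; 2F _ → trans p same₁₂ ; 3F _ → same₀₃ })
                (λ j ≢l → rests j (≢l ∘ cong inj₂))
      constant (no p) = ⊥-elim (¬partition record
        { side = χ ; bridge = just l ; same₀₃ = same₀₃ ; same₁₂ = same₁₂
        ; separated = p ; uncrossed = λ j ≢l → rests j (≢l ∘ cong just ∘ sym) })

    module Labels {n} (𝒟 : Fin n → ∃ (Cycle H)) (once : TraversesOnceEachWay 𝒟) where

      open LabellingFromCDC H 𝒟 once
      private
        module R = Replacement replacement
        B = ⟦ H ⟧

      differ : ∀ i → R.arrive {o = face} {face ∘ rev B} face-good (λ _ _ → refl) i
                   ≢ R.depart {o = face} {face ∘ rev B} face-good (λ _ _ → refl) i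
      differ = R.arrive≢depart {o = face} {face ∘ rev B} face-good (λ _ _ → refl)

      -- When 03, 12 share a face and 30, 21 share another one, both faces are bisected first.
      crossed : face e₀₃ ≡ face e₁₂ → face e₃₀ ≡ face e₂₁ → FaceLabelling A
      crossed p q = R.extend {o = refined-out β} {refined-in β} (refined-good β) old-const
        (crossing _ _ (cong just to₂) (cong just to₃) (cong just to₀) (cong just to₁)
          -- The labels at 0 and 1 come from one face and those at 2 and 3 from another, and the
          -- sides tell these apart; mixed pairs differ because the two faces run along one edge in
          -- opposite directions.
          (λ r → S.side-separate (cong (proj₁ ∘ proj₂) (just-injective r)))
          (λ r → distinct (trans (cong proj₁ (just-injective r)) (sym q)))
          (λ r → distinct (cong proj₁ (just-injective r)))
          (λ r → distinct (trans p (trans (cong proj₁ (just-injective r)) (sym q))))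
          (λ r → distinct (trans p (cong proj₁ (just-injective r))))
          (λ r → T.side-separate (sym (cong (proj₂ ∘ proj₂) (just-injective r)))))
        where
        module S = Bisection (bisect e₀₃ e₁₂ (λ ()) p)
        module T = Bisection (bisect e₃₀ e₂₁ (λ ()) q)

        β : Dart B → Bool × Bool
        β d = S.side d , T.side d

        distinct : face e₀₃ ≢ face e₃₀
        distinct = face-rev e₀₃

        S-off : ∀ {d} → face d ≡ face e₃₀ → S.side d ≡ false
        S-off {d} r = S.side-off d (λ s → distinct (trans (sym s) r))

        T-off : ∀ {d} → face d ≡ face e₀₃ → T.side d ≡ false
        T-off {d} r = T.side-off d (λ s → distinct (trans (sym r) s))

        -- The arc that ends at foot 0 begins just after `e₁₂`, hence at foot 2: cutting both new
        -- edges leaves arcs that the rim must close between opposite spokes. The other face has a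
        -- constant side off its own darts, so its coordinate agrees trivially.
        to₂ : refined-out β e₀₃ ≡ refined-in β e₂₁
        to₂ = cong₂ _,_ p (cong₂ _,_ S.side-a
          (trans (T-off refl) (sym (T-off (trans (follow-face e₁₂) (sym p))))))

        to₃ : refined-out β e₁₂ ≡ refined-in β e₃₀
        to₃ = cong₂ _,_ (sym p) (cong₂ _,_ S.side-b
          (trans (T-off (sym p)) (sym (T-off (follow-face e₀₃)))))

        to₀ : refined-out β e₂₁ ≡ refined-in β e₀₃
        to₀ = cong₂ _,_ (sym q) (cong₂ _,_
          (trans (S-off (sym q)) (sym (S-off (follow-face e₃₀)))) T.side-b)

        to₁ : refined-out β e₃₀ ≡ refined-in β e₁₂
        to₁ = cong₂ _,_ q (cong₂ _,_
          (trans (S-off refl) (sym (S-off (trans (follow-face e₂₁) (sym q))))) T.side-a)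

        old-const : ∀ j b → refined-in β (suc (suc j) , b) ≡ refined-out β (suc (suc j) , not b)
        old-const j b = cong (face (suc (suc j) , not b) ,_)
          (cong₂ _,_ (S.side-const _ (λ ()) (λ ())) (T.side-const _ (λ ()) (λ ())))

      labels : FaceLabelling A
      -- In the notation of the overview the tests are F₁ = F₄, F₂ = F₃, F₁ = F₃ and F₂ = F₄.
      labels with face e₀₃ ≟ face e₂₁ | face e₃₀ ≟ face e₁₂ | face e₀₃ ≟ face e₁₂ | face e₃₀ ≟ face e₂₁
      ... | yes p | _ | _ | _ = R.extend face-good (λ _ _ → refl) (rimFace⁻ _ _ differ
            λ { 0F → p ; 1F → refl ; 2F → sym p ; 3F → refl })
      ... | no _ | yes p | _ | _ = R.extend face-good (λ _ _ → refl) (rimFace⁺ _ _ differ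
            λ { 0F → sym p ; 1F → refl ; 2F → p ; 3F → refl })
      ... | no ¬p | no ¬q | no ¬r | _ = R.extend face-good (λ _ _ → refl) (detour₀₁ _ _ refl refl refl refl
            (face-rev e₀₃ ∘ just-injective) (face-rev e₁₂ ∘ just-injective) (¬p ∘ just-injective)
            (¬q ∘ sym ∘ just-injective) (¬r ∘ just-injective))
      ... | no ¬p | no ¬q | yes _ | no ¬s = R.extend face-good (λ _ _ → refl) (detour₂₃ _ _ refl refl refl refl
            (face-rev e₀₃ ∘ just-injective) (face-rev e₁₂ ∘ just-injective) (¬p ∘ just-injective)
            (¬q ∘ sym ∘ just-injective) (¬s ∘ sym ∘ just-injective))
      ... | no _ | no _ | yes r | yes s = crossed r s

    absurd : ⊥
    absurd = irreducible critical I H minorMap {rim 0F} (λ { 0F () ; 1F () ; (suc (suc _)) () })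
      (2≤-distinct feet₀₃-differ)
      (λ v → Degree3-transport (Replacement.localIso replacement v) (Iso.degree3 I cubic (outer v)))
      bridgelessH
      λ (_ , 𝒟 , _ , once) → Labels.labels 𝒟 once

-- Chords of short cycles

others₂ : ∀ (i j k : Fin 2) → j ≢ i → k ≡ i ⊎ k ≡ j
others₂ 0F 0F _  j≢i = contradiction refl j≢i
others₂ 0F 1F 0F _   = inj₁ refl
others₂ 0F 1F 1F _   = inj₂ refl
others₂ 1F 0F 0F _   = inj₂ refl
others₂ 1F 0F 1F _   = inj₁ refl
others₂ 1F 1F _  j≢i = contradiction refl j≢i

positions₃ : ∀ (i j : Fin 3) → j ≡ i ⊎ j ≡ next i ⊎ j ≡ prev i
positions₃ = toWitness {a? = all? λ i → all? λ j → (j ≟ i) ⊎-dec ((j ≟ next i) ⊎-dec (j ≟ prev i))} _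

positions₄ : ∀ (i j : Fin 4) → j ≡ i ⊎ j ≡ next i ⊎ j ≡ prev i ⊎ j ≡ next (next i)
positions₄ = toWitness {a? = all? λ i → all? λ j →
  (j ≟ i) ⊎-dec ((j ≟ next i) ⊎-dec ((j ≟ prev i) ⊎-dec (j ≟ next (next i))))} _

steps₃ : ∀ (i : Fin 3) → next (next i) ≢ i × next (next i) ≢ next i × next i ≢ i × next i ≢ prev i
steps₃ = toWitness {a? = all? λ i → ¬? (next (next i) ≟ i) ×-dec
  (¬? (next (next i) ≟ next i) ×-dec (¬? (next i ≟ i) ×-dec ¬? (next i ≟ prev i)))} _

steps₄ : ∀ (i : Fin 4) → next (next i) ≢ i × next (next i) ≢ next i × next i ≢ i × next i ≢ prev i
steps₄ = toWitness {a? = all? λ i → ¬? (next (next i) ≟ i) ×-dec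
  (¬? (next (next i) ≟ next i) ×-dec (¬? (next i ≟ i) ×-dec ¬? (next i ≟ prev i)))} _

injective₃ : ∀ {A : Set} {a b c : A} → a ≢ b → b ≢ c → a ≢ c →
             (f : Fin 3 → A) → f 0F ≡ a → f 1F ≡ b → f 2F ≡ c → Injective _≡_ _≡_ f
injective₃ ab bc ac f refl refl refl {0F} {0F} _  = refl
injective₃ ab bc ac f refl refl refl {0F} {1F} eq = contradiction eq ab
injective₃ ab bc ac f refl refl refl {0F} {2F} eq = contradiction eq ac
injective₃ ab bc ac f refl refl refl {1F} {0F} eq = contradiction (sym eq) ab
injective₃ ab bc ac f refl refl refl {1F} {1F} _  = refl
injective₃ ab bc ac f refl refl refl {1F} {2F} eq = contradiction eq bc
injective₃ ab bc ac f refl refl refl {2F} {0F} eq = contradiction (sym eq) ac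
injective₃ ab bc ac f refl refl refl {2F} {1F} eq = contradiction (sym eq) bc
injective₃ ab bc ac f refl refl refl {2F} {2F} _  = refl

module _ (G : Graph) where

  open Graph G using (Joins)

  Joins-sym : ∀ {e u v} → Joins e u v → Joins e v u
  Joins-sym (inj₁ j) = inj₂ j
  Joins-sym (inj₂ j) = inj₁ j

  Joins-end : ∀ {e a b c d} → Joins e a b → Joins e c d → c ≡ a ⊎ c ≡ b
  Joins-end (inj₁ (p , _)) (inj₁ (q , _)) = inj₁ (trans (sym q) p)
  Joins-end (inj₁ (_ , p)) (inj₂ (_ , q)) = inj₂ (trans (sym q) p)
  Joins-end (inj₂ (p , _)) (inj₁ (q , _)) = inj₂ (trans (sym q) p)
  Joins-end (inj₂ (_ , p)) (inj₂ (_ , q)) = inj₁ (trans (sym q) p)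

  digon : ∀ {e e′ u v} → Joins e u v → Joins e′ u v → e ≢ e′ → u ≢ v → Cycle G 2
  digon {e} {e′} {u} {v} j j′ e≢e′ u≢v = record
    { 2≤length = s≤s (s≤s z≤n)
    ; vertex = λ { 0F → u ; 1F → v }
    ; edge = λ { 0F → e ; 1F → e′ }
    ; vertex-injective = λ { {0F} {0F} _ → refl ; {1F} {1F} _ → refl
                           ; {0F} {1F} eq → contradiction eq u≢v ; {1F} {0F} eq → contradiction (sym eq) u≢v }
    ; edge-injective = λ { {0F} {0F} _ → refl ; {1F} {1F} _ → refl
                         ; {0F} {1F} eq → contradiction eq e≢e′ ; {1F} {0F} eq → contradiction (sym eq) e≢e′ }
    ; edge-joins = λ { 0F → j ; 1F → Joins-sym j′ }
    }

  triangle : ∀ {e e′ e″ u v w} → Joins e u v → Joins e′ v w → Joins e″ w u →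
             e ≢ e′ → e′ ≢ e″ → e ≢ e″ → u ≢ v → v ≢ w → u ≢ w → Cycle G 3
  triangle {e} {e′} {e″} {u} {v} {w} j j′ j″ ee′ e′e″ ee″ uv vw uw = record
    { 2≤length = s≤s (s≤s z≤n)
    ; vertex = λ { 0F → u ; 1F → v ; 2F → w }
    ; edge = λ { 0F → e ; 1F → e′ ; 2F → e″ }
    ; vertex-injective = injective₃ uv vw uw _ refl refl refl
    ; edge-injective = injective₃ ee′ e′e″ ee″ _ refl refl refl
    ; edge-joins = λ { 0F → j ; 1F → j′ ; 2F → j″ }
    }

module _ {G : Graph} (critical : Critical G) where

  open Critical critical
  open Graph G using (Joins)

  private A = ⟦ G ⟧

  module _ {K} (C : Cycle G K) where

    open Cycle C
    open Legs G cubic C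

    Chord : Set
    Chord = ∃₂ λ i j → vertex j ≡ head A (leg i)

    chord? : Dec Chord
    chord? = any? λ i → any? λ j → vertex j ≟ head A (leg i)

    leg-joins : ∀ {i j} → vertex j ≡ head A (leg i) → Joins (proj₁ (leg i)) (vertex i) (vertex j)
    leg-joins {i} eq = subst₂ (Joins (proj₁ (leg i))) (leg-tail i) (sym eq) (joins-dart G (leg i))

    leg-not-loop : ∀ {i j} → vertex j ≡ head A (leg i) → j ≢ i
    leg-not-loop {i} eq refl = no-loop G (leg i) (trans (leg-tail i) eq)

    prev-joins : ∀ i → Joins (edge (prev i)) (vertex i) (vertex (prev i))
    prev-joins i = Joins-sym G (subst (λ k → Joins (edge (prev i)) (vertex (prev i)) (vertex k))
                                    (next-prev i) (edge-joins (prev i)))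

    chord-next : ∀ {i} → vertex (next i) ≡ head A (leg i) → Cycle G 2
    chord-next {i} eq = digon G (leg-joins eq) (edge-joins i) (leg≢edge i)
      (λ p → leg-not-loop eq (vertex-injective (sym p)))

    chord-prev : ∀ {i} → vertex (prev i) ≡ head A (leg i) → Cycle G 2
    chord-prev {i} eq = digon G (leg-joins eq) (prev-joins i) (leg≢edge-prev i)
      (λ p → leg-not-loop eq (vertex-injective (sym p)))

  -- If a leg joins the two vertices of the digon, these form a whole component with three parallel
  -- edges. The vertex `z` rules this out; the triangle or square from which the digon arises
  -- supplies it.
  no-digon : (C : Cycle G 2) → ∀ z → z ≢ Cycle.vertex C 0F → z ≢ Cycle.vertex C 1F → ⊥
  no-digon C z z≢₀ z≢₁ with chord? C
  ... | no ¬chord = Digon.absurd critical frame iso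
    where open Legs.Outward G cubic C (λ i j eq → ¬chord (i , j , eq))
  ... | yes (i , j , eq) = missed (does-true (onCycle? z) (trans (sym whole) (dec-true (onCycle? (vertex 0F)) (0F , refl))))
    where
    open Cycle C
    open Legs G cubic C

    OnCycle : Graph.Vertex G → Set
    OnCycle v = ∃ λ k → vertex k ≡ v

    onCycle? : ∀ v → Dec (OnCycle v)
    onCycle? v = any? λ k → vertex k ≟ v

    j≢i : j ≢ i
    j≢i = leg-not-loop C eq

    leg-reverse : rev A (leg i) ≡ leg j
    leg-reverse with leg-complete j (rev A (leg i)) (sym eq)
    ... | inj₂ (inj₂ p) = p
    ... | inj₁ p with others₂ i (prev i) j (λ q → next-≢ 2≤length i (trans (cong next (sym q)) (next-prev i)))
    ...   | inj₁ q = contradiction q j≢i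
    ...   | inj₂ q = contradiction (trans p (cong edge q)) (leg≢edge-prev i)
    leg-reverse | inj₂ (inj₁ p) with others₂ i j (prev j) j≢i
    ...   | inj₁ q = contradiction (trans p (cong edge q)) (leg≢edge i)
    ...   | inj₂ q = contradiction (trans (sym (next-prev j)) (cong next q)) (next-≢ 2≤length j ∘ sym)

    stays : ∀ d → OnCycle (tail A d) → OnCycle (head A d)
    stays d (k , p) with leg-complete k d (sym p)
    ... | inj₁ q        = cycle-end k d q
    ... | inj₂ (inj₁ q) = cycle-end (prev k) d q
    ... | inj₂ (inj₂ refl) with others₂ i j k j≢i
    ...   | inj₁ refl = j , eq
    ...   | inj₂ refl = i , trans (sym (leg-tail i))
              (trans (cong (tail A) (sym (Multigraph.rev-rev A (leg i)))) (cong (head A) leg-reverse))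

    whole : does (onCycle? (vertex 0F)) ≡ does (onCycle? z)
    whole = bridgeless (λ v → does (onCycle? v)) (edge 0F)
      (λ e _ → does-⇔ (mk⇔ (stays (e , false)) (stays (e , true))) (onCycle? _) (onCycle? _)) (vertex 0F) z

    does-true : ∀ {P : Set} (P? : Dec P) → does P? ≡ true → P
    does-true (yes p) _ = p
    does-true (no _) ()

    missed : ¬ OnCycle z
    missed (0F , p) = z≢₀ (sym p)
    missed (1F , p) = z≢₁ (sym p)

  -- A chord of a triangle is parallel to a side, and the third corner lies off the resulting digon.
  no-triangle : ¬ Cycle G 3
  no-triangle C with chord? C
  ... | no ¬chord = Triangle.absurd critical frame iso
    where open Legs.Outward G cubic C (λ i j eq → ¬chord (i , j , eq))
  ... | yes (i , j , eq) with positions₃ i j | steps₃ i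
  ...   | inj₁ j≡i         | _ = leg-not-loop C eq j≡i
  ...   | inj₂ (inj₁ refl) | ≢i , ≢next , _ = no-digon (chord-next C eq) (vertex (next (next i)))
            (≢i ∘ vertex-injective) (≢next ∘ vertex-injective)
    where open Cycle C
  ...   | inj₂ (inj₂ refl) | _ , _ , ≢i , ≢prev = no-digon (chord-prev C eq) (vertex (next i))
            (≢i ∘ vertex-injective) (≢prev ∘ vertex-injective)
    where open Cycle C

  -- Without a chord each pairing fails only because of a partition. Whether one exists is never
  -- decided: it is received as the argument of a refutation, and the two partitions clash. A chord
  -- is either parallel to a side or a diagonal, which closes a triangle with two sides.
  no-square : ¬ Cycle G 4
  no-square C with chord? C
  ... | no ¬chord = Square.absurd critical frame iso λ P →
          Square.absurd critical (rotate frame) (rotate-iso iso) λ Q →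
          PartitionClash.absurd frame (Iso.noBridge iso bridgeless) (Iso.degree3 iso cubic) (Iso.noLoop iso) P Q
    where open Legs.Outward G cubic C (λ i j eq → ¬chord (i , j , eq))
  ... | yes (i , j , eq) with positions₄ i j | steps₄ i
  ...   | inj₁ j≡i         | _ = leg-not-loop C eq j≡i
  ...   | inj₂ (inj₁ refl) | ≢i , ≢next , _ = no-digon (chord-next C eq) (vertex (next (next i)))
            (≢i ∘ vertex-injective) (≢next ∘ vertex-injective)
    where open Cycle C
  ...   | inj₂ (inj₂ (inj₁ refl)) | _ , _ , ≢i , ≢prev = no-digon (chord-prev C eq) (vertex (next i))
            (≢i ∘ vertex-injective) (≢prev ∘ vertex-injective)
    where open Cycle C
  ...   | inj₂ (inj₂ (inj₂ refl)) | ≢i , ≢next , next≢ , _ = no-triangle (triangle G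
            (edge-joins i) (edge-joins (next i)) (Joins-sym G (leg-joins C eq))
            (next≢ ∘ sym ∘ edge-injective) leg≢next (leg≢edge i ∘ sym)
            (next≢ ∘ sym ∘ vertex-injective) (≢next ∘ sym ∘ vertex-injective) (≢i ∘ sym ∘ vertex-injective))
    where
    open Cycle C
    open Legs G cubic C

    leg≢next : edge (next i) ≢ proj₁ (leg i)
    leg≢next p with Joins-end G (edge-joins (next i)) (subst (λ e → Joins e _ _) (sym p) (leg-joins C eq))
    ... | inj₁ q = next≢ (vertex-injective (sym q))
    ... | inj₂ q = ≢i (vertex-injective (sym q))

lemma4p2 : ∀ {ℓ : Level} (𝒢 : Pred Graph ℓ) →
    𝒢 ⊆ 𝒞₂ →
    MinorClosedIn𝒞₂ 𝒢 →
    (G : Graph) →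
    𝒢 G →
    ¬ HasOrientableCDC G →
    (∀ H → 𝒢 H → ¬ HasOrientableCDC H → Graph.#E G ≤ Graph.#E H) →
    ¬ Cycle G 4
lemma4p2 𝒢 𝒢⊆𝒞₂ closed G G∈𝒢 ¬cdc fewest = no-square record
  { cubic      = cubic
  ; bridgeless = TwoConnected⇒NoBridge G cubic (proj₁ (𝒢⊆𝒞₂ G∈𝒢))
  ; no-CDC     = ¬cdc
  ; minimal    = λ H H∈𝒞₂ H≼G fewer ¬cdcH → ℕₚ.<⇒≱ fewer (fewest H (closed G H G∈𝒢 H∈𝒞₂ H≼G) ¬cdcH)
  }
  where
  cubic : ∀ v → Degree3 ⟦ G ⟧ v
  cubic v = degree⇒Degree3 G v (proj₂ (𝒢⊆𝒞₂ G∈𝒢) v)
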